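{- Let $\alpha:A^{\Delta}\to(H,V)$ be a homomorphism onto a finite forest algebra and let $k>0$. The following are equivalent: (a) $\alpha$ is $k$-definite; (b) $\alpha$ factors through $\alpha_{A,k}$; (c) $\alpha$ factors through $\beta_1\otimes\cdots\otimes\beta_k:A^{\Delta}\to(H_1,V_1)\circ\cdots\circ(H_k,V_k)$ for some homomorphisms $\beta_i:(A\times H_1\times\cdots\times H_{i-1})^{\Delta}\to(H_i,V_i)$ that are each 1-definite; (d) $\alpha$ factors through an iterated wreath product of 1-definite homomorphisms into ${\cal U}_2$.
   Context: $A^{\Delta}=(H_A,V_A)$: free forest algebra over finite alphabet $A$; $H_A$ forests (finite ordered sequences of finite ordered $A$-labelled trees) under concatenation $+$; $V_A$ contexts (forests with exactly one leaf replaced by a hole) under substitution, acting by substitution. A forest algebra $(H,V)$: additive monoid $H$, monoid $V$, faithful left action with $g\mapsto g+h$ and $g\mapsto h+g$ in $V$; all finite forest algebras considered have $H$ idempotent and commutative. $\beta$ factors through $\alpha$ if $\alpha(s)=\alpha(s')$ implies $\beta(s)=\beta(s')$ for forests $s,s'$. The depth of a context is the depth of its hole (roots have depth $0$). $\alpha$ is $k$-definite if $\alpha(ps)=\alpha(ps')$ for every context $p$ of depth at least $k$ and all forests $s,s'$; it is 1-definite iff $\alpha(s)$ depends only on the set of labels of root nodes of $s$. For an alphabet $B$, equivalences $\sim_k$ on $H_B$: $\sim_0$ identifies all forests; for $s=b_1s_1+\cdots+b_rs_r$ ($b_i\in B$, $s_i\in H_B$) put $T^{k+1}_s=\{(b_i,[s_i]_{\sim_k})\}$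 and $s\sim_{k+1}s'$ iff $T^{k+1}_s=T^{k+1}_{s'}$. Each $\sim_k$ is a congruence; $\alpha_{B,k}:B^{\Delta}\to B^{\Delta}/{\sim_k}$ is the quotient homomorphism. Wreath product: $(H_1,V_1)\circ(H_2,V_2)=(H_1\times H_2,V_1\times V_2^{H_1})$ with $(v,f)(h_1,h_2)=(vh_1,f(h_1)h_2)$. For $\alpha:A^{\Delta}\to(H_1,V_1)$ and $\beta:(A\times H_1)^{\Delta}\to(H_2,V_2)$, $\alpha\otimes\beta$ maps $a$ to $(\alpha(a),h\mapsto\beta(a,h))$; iterated products $\beta_1\otimes\cdots\otimes\beta_k$ with $\beta_i:(A\times H_1\times\cdots\times H_{i-1})^{\Delta}\to(H_i,V_i)$ are formed likewise. ${\cal U}_2=(\{0,\infty\},\{1,0,c_0\})$ with $0+x=x$, $\infty+x=\infty$, $1$ the identity, vertical $0$ the constant map to $\infty$, and $c_0$ the constant map to $0$.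
   Formalization: As stated, (d) does not imply (a) for fixed k; (d) is replaced for fixed k by a k-level wreath product of 1-definite homomorphisms into direct powers of U_2, and (d) as worded (any number of factors U_2) is proved equivalent to α being k-definite for some k>0. -}

module Defs where

open import Level using (0ℓ; Level; _⊔_) renaming (suc to lsuc)
open import Algebra.Bundles using (Monoid)
open import Algebra.Definitions using (Commutative; Idempotent)
open import Algebra.Morphism.Structures using (module MonoidMorphisms)
import Algebra.Construct.DirectProduct as DirectProduct
open import Data.Empty using (⊥; ⊥-elim)
open import Data.Fin.Base using (Fin)
open import Data.List.Base using (List; []; _∷_; _++_; map)
import Data.List.Properties as List
open import Data.List.Relation.Binary.Pointwise using (Pointwise; []; _∷_)
import Data.List.Relation.Binary.Pointwise as Pointwise
open import Data.List.Relation.Unary.Any as Any using (Any; here; there)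
import Data.List.Relation.Binary.Subset.Setoid as Subset
import Data.List.Relation.Binary.Subset.Setoid.Properties as Subsetₚ
open import Data.Nat.Base as ℕ using (ℕ; zero; suc; _≤_; _<_)
import Data.Nat.Properties as ℕ
open import Data.Product.Base using (Σ-syntax; _×_; _,_; proj₁; proj₂)
open import Data.Product.Relation.Binary.Pointwise.NonDependent using (_×ₛ_)
open import Data.Unit.Base using (⊤; tt)
open import Function.Bundles using (Func; _⟨$⟩_; Inverse)
open import Function.Definitions using (StrictlySurjective)
import Function.Relation.Binary.Setoid.Equality as FuncEquality
open import Relation.Binary.Bundles using (Setoid)
open import Relation.Binary.Structures using (IsEquivalence)
open import Relation.Binary.PropositionalEquality as ≡ using (_≡_)
import Relation.Binary.Reasoning.Setoid as SetoidReasoning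

------------------------------------------------------------------------
-- Forest algebras.  Equality is setoid equality throughout, since there
-- are no quotient types (for the congruences ∼ₖ) and no function
-- extensionality (for the vertical monoid of a wreath product).

-- The maps g ↦ h + g and g ↦ g + h belong to V: they are the actions of
-- inˡ h and inʳ h, which are unique by faithfulness.

record ForestAlgebra : Set (lsuc 0ℓ) where
  infixr 7 _·_
  field
    horizontal : Monoid 0ℓ 0ℓ
    vertical   : Monoid 0ℓ 0ℓ

  module H = Monoid horizontal renaming (_∙_ to infixl 6 _+_; ε to 𝟘)
  module V = Monoid vertical   renaming (_∙_ to infixl 7 _∘_; ε to 𝟙)

  field
    _·_        : V.Carrier → H.Carrier → H.Carrier
    ·-cong     : ∀ {v w g h} → v V.≈ w → g H.≈ h → v · g H.≈ w · h
    ·-identity : ∀ h → V.𝟙 · h H.≈ h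
    ·-assoc    : ∀ v w h → (v V.∘ w) · h H.≈ v · (w · h)
    faithful   : ∀ {v w} → (∀ h → v · h H.≈ w · h) → v V.≈ w
    inˡ        : H.Carrier → V.Carrier
    inʳ        : H.Carrier → V.Carrier
    inˡ-·      : ∀ h g → inˡ h · g H.≈ h H.+ g
    inʳ-·      : ∀ h g → inʳ h · g H.≈ g H.+ h

-- The monoid laws of V follow from faithfulness.

forestAlgebra :
  (M : Monoid 0ℓ 0ℓ) (S : Setoid 0ℓ 0ℓ)
  (let module M = Monoid M; module S = Setoid S)
  (_∘_ : S.Carrier → S.Carrier → S.Carrier) (𝟙 : S.Carrier)
  (_·_ : S.Carrier → M.Carrier → M.Carrier) →
  (∀ {v w g h} → v S.≈ w → g M.≈ h → (v · g) M.≈ (w · h)) →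
  (∀ h → (𝟙 · h) M.≈ h) →
  (∀ v w h → ((v ∘ w) · h) M.≈ (v · (w · h))) →
  (∀ {v w} → (∀ h → (v · h) M.≈ (w · h)) → v S.≈ w) →
  (inˡ inʳ : M.Carrier → S.Carrier) →
  (∀ h g → (inˡ h · g) M.≈ (h M.∙ g)) →
  (∀ h g → (inʳ h · g) M.≈ (g M.∙ h)) →
  ForestAlgebra
forestAlgebra M S _∘_ 𝟙 _·_ cong identity assoc faithful inˡ inʳ inˡ-· inʳ-· = record
  { horizontal = M
  ; vertical   = record
    { Carrier  = S.Carrier
    ; _≈_      = S._≈_
    ; _∙_      = _∘_
    ; ε        = 𝟙
    ; isMonoid = record
      { isSemigroup = record
        { isMagma = record
          { isEquivalence = S.isEquivalence
          ; ∙-cong = λ {v} {v′} {w} {w′} v≈v′ w≈w′ → faithful λ h → begin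
              (v ∘ w) · h    ≈⟨ assoc v w h ⟩
              v · (w · h)    ≈⟨ cong v≈v′ (cong w≈w′ M.refl) ⟩
              v′ · (w′ · h)  ≈⟨ assoc v′ w′ h ⟨
              (v′ ∘ w′) · h  ∎
          }
        ; assoc = λ u v w → faithful λ h → begin
            ((u ∘ v) ∘ w) · h  ≈⟨ assoc (u ∘ v) w h ⟩
            (u ∘ v) · (w · h)  ≈⟨ assoc u v (w · h) ⟩
            u · (v · (w · h))  ≈⟨ cong S.refl (assoc v w h) ⟨
            u · ((v ∘ w) · h)  ≈⟨ assoc u (v ∘ w) h ⟨
            (u ∘ (v ∘ w)) · h  ∎
        }
      ; identity =
          (λ v → faithful λ h → M.trans (assoc 𝟙 v h) (identity (v · h)))
        , (λ v → faithful λ h → M.trans (assoc v 𝟙 h) (cong S.refl (identity h)))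
      }
    }
  ; _·_        = _·_
  ; ·-cong     = cong
  ; ·-identity = identity
  ; ·-assoc    = assoc
  ; faithful   = faithful
  ; inˡ        = inˡ
  ; inʳ        = inʳ
  ; inˡ-·      = inˡ-·
  ; inʳ-·      = inʳ-·
  }
  where
  module M = Monoid M
  module S = Setoid S
  open SetoidReasoning M.setoid

hSetoid : ForestAlgebra → Setoid 0ℓ 0ℓ
hSetoid F = ForestAlgebra.H.setoid F

vSetoid : ForestAlgebra → Setoid 0ℓ 0ℓ
vSetoid F = ForestAlgebra.V.setoid F

Finite : Setoid 0ℓ 0ℓ → Set
Finite S = Σ[ n ∈ ℕ ] Inverse S (≡.setoid (Fin n))

-- H is assumed idempotent and commutative in all finite forest algebras.

record IsFiniteForestAlgebra (F : ForestAlgebra) : Set where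
  open ForestAlgebra F
  field
    H-finite     : Finite H.setoid
    V-finite     : Finite V.setoid
    +-comm       : Commutative H._≈_ H._+_
    +-idempotent : Idempotent H._≈_ H._+_

------------------------------------------------------------------------
-- Homomorphisms

record Hom (F G : ForestAlgebra) : Set where
  private
    module F = ForestAlgebra F
    module G = ForestAlgebra G
    module MH = MonoidMorphisms F.H.rawMonoid G.H.rawMonoid
    module MV = MonoidMorphisms F.V.rawMonoid G.V.rawMonoid
  field
    onH      : F.H.Carrier → G.H.Carrier
    onV      : F.V.Carrier → G.V.Carrier
    onH-homo : MH.IsMonoidHomomorphism onH
    onV-homo : MV.IsMonoidHomomorphism onV
    ·-homo   : ∀ v h → onH (v F.· h) G.H.≈ onV v G.· onH h
    inˡ-homo : ∀ h → onV (F.inˡ h) G.V.≈ G.inˡ (onH h)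
    inʳ-homo : ∀ h → onV (F.inʳ h) G.V.≈ G.inʳ (onH h)

Onto : ∀ {F G} → Hom F G → Set
Onto {G = G} α =
    StrictlySurjective G.H._≈_ (Hom.onH α)
  × StrictlySurjective G.V._≈_ (Hom.onV α)
  where module G = ForestAlgebra G

infix 4 _FactorsThrough_

_FactorsThrough_ : ∀ {E F G} → Hom E G → Hom E F → Set
_FactorsThrough_ {E} {F} {G} β α =
  ∀ s s′ → Hom.onH α s F.H.≈ Hom.onH α s′ → Hom.onH β s G.H.≈ Hom.onH β s′
  where
  module F = ForestAlgebra F
  module G = ForestAlgebra G

------------------------------------------------------------------------
-- Forests and contexts

data Tree (A : Set) : Set where
  node : A → List (Tree A) → Tree A

Forest : Set → Set
Forest A = List (Tree A)

-- hole l r is l + □ + r, and below l a p r is l + a p + r.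

data Context (A : Set) : Set where
  hole  : (l r : Forest A) → Context A
  below : (l : Forest A) (a : A) (p : Context A) (r : Forest A) → Context A

module _ {A : Set} where

  depth : Context A → ℕ
  depth (hole l r)      = 0
  depth (below l a p r) = suc (depth p)

  plug : Context A → Forest A → Forest A
  plug (hole l r)      s = l ++ s ++ r
  plug (below l a p r) s = l ++ node a (plug p s) ∷ r

  surround : Forest A → Context A → Forest A → Context A
  surround l (hole l′ r′)      r = hole (l ++ l′) (r′ ++ r)
  surround l (below l′ a p r′) r = below (l ++ l′) a p (r′ ++ r)

  compose : Context A → Context A → Context A
  compose (hole l r)      q = surround l q r
  compose (below l a p r) q = below l a (compose p q) r

  plug-surround : ∀ l p r s → plug (surround l p r) s ≡ l ++ plug p s ++ r
  plug-surround l (hole l′ r′) r s = begin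
    (l ++ l′) ++ s ++ r′ ++ r    ≡⟨ List.++-assoc l l′ _ ⟩
    l ++ l′ ++ s ++ r′ ++ r      ≡⟨ ≡.cong (λ x → l ++ l′ ++ x) (List.++-assoc s r′ r) ⟨
    l ++ l′ ++ (s ++ r′) ++ r    ≡⟨ ≡.cong (l ++_) (List.++-assoc l′ (s ++ r′) r) ⟨
    l ++ (l′ ++ s ++ r′) ++ r    ∎
    where open ≡.≡-Reasoning
  plug-surround l (below l′ a p r′) r s = begin
    (l ++ l′) ++ node a (plug p s) ∷ r′ ++ r    ≡⟨ List.++-assoc l l′ _ ⟩
    l ++ l′ ++ node a (plug p s) ∷ r′ ++ r      ≡⟨ ≡.cong (l ++_) (List.++-assoc l′ _ r) ⟨
    l ++ (l′ ++ node a (plug p s) ∷ r′) ++ r    ∎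
    where open ≡.≡-Reasoning

  plug-compose : ∀ p q s → plug (compose p q) s ≡ plug p (plug q s)
  plug-compose (hole l r)      q s = plug-surround l q r s
  plug-compose (below l a p r) q s =
    ≡.cong (λ x → l ++ node a x ∷ r) (plug-compose p q s)

  sizeT : Tree A → ℕ
  size  : Forest A → ℕ
  sizeT (node a s) = suc (size s)
  size []      = 0
  size (t ∷ s) = sizeT t ℕ.+ size s

  size-++ : ∀ s s′ → size (s ++ s′) ≡ size s ℕ.+ size s′
  size-++ []      s′ = ≡.refl
  size-++ (t ∷ s) s′ =
    ≡.trans (≡.cong (sizeT t ℕ.+_) (size-++ s s′))
            (≡.sym (ℕ.+-assoc (sizeT t) (size s) (size s′)))

  size-middle : ∀ l s r → size s ≤ size (l ++ s ++ r)
  size-middle l s r = begin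
    size s                               ≤⟨ ℕ.m≤m+n _ _ ⟩
    size s ℕ.+ size r                    ≡⟨ size-++ s r ⟨
    size (s ++ r)                        ≤⟨ ℕ.m≤n+m _ _ ⟩
    size l ℕ.+ size (s ++ r)             ≡⟨ size-++ l (s ++ r) ⟨
    size (l ++ s ++ r)                   ∎
    where open ℕ.≤-Reasoning

  size-plug : ∀ p s → size s ≤ size (plug p s)
  size-plug (hole l r)      s = size-middle l s r
  size-plug (below l a p r) s = begin
    size s                               ≤⟨ size-plug p s ⟩
    size (plug p s)                      ≤⟨ ℕ.n≤1+n _ ⟩
    suc (size (plug p s))                ≤⟨ ℕ.m≤m+n _ 0 ⟩
    size (node a (plug p s) ∷ [])        ≤⟨ size-middle l _ r ⟩
    size (l ++ node a (plug p s) ∷ r)    ∎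
    where open ℕ.≤-Reasoning

  tower : A → ℕ → Tree A
  tower a zero    = node a []
  tower a (suc n) = node a (tower a n ∷ [])

  size-tower : ∀ a n → n < sizeT (tower a n)
  size-tower a zero    = ℕ.s≤s ℕ.z≤n
  size-tower a (suc n) =
    ℕ.s≤s (ℕ.≤-trans (size-tower a n) (ℕ.m≤m+n _ 0))

  sizeC : Context A → ℕ
  sizeC (hole l r)      = size l
  sizeC (below l a p r) = size l ℕ.+ sizeC p

------------------------------------------------------------------------
-- The free forest algebra.  Alphabets are setoids, because the letters
-- of the alphabets A × H₁ × ⋯ × Hᵢ₋₁ contain elements of the setoids Hⱼ.

module _ (A : Setoid 0ℓ 0ℓ) where
  private module A = Setoid A

  data TreeEq : Tree A.Carrier → Tree A.Carrier → Set where
    node : ∀ {a b s t} → a A.≈ b → Pointwise TreeEq s t → TreeEq (node a s) (node b t)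

  ForestEq : Forest A.Carrier → Forest A.Carrier → Set
  ForestEq = Pointwise TreeEq

  data ContextEq : Context A.Carrier → Context A.Carrier → Set where
    hole  : ∀ {l l′ r r′} → ForestEq l l′ → ForestEq r r′ →
            ContextEq (hole l r) (hole l′ r′)
    below : ∀ {l l′ a a′ p p′ r r′} →
            ForestEq l l′ → a A.≈ a′ → ContextEq p p′ → ForestEq r r′ →
            ContextEq (below l a p r) (below l′ a′ p′ r′)

module _ {A : Setoid 0ℓ 0ℓ} where
  private module A = Setoid A

  forest-refl : ∀ {s} → ForestEq A s s
  forest-refl {[]}         = []
  forest-refl {node a s ∷ t} = node A.refl forest-refl ∷ forest-refl

  forest-sym : ∀ {s t} → ForestEq A s t → ForestEq A t s
  forest-sym []               = []
  forest-sym (node e p ∷ q) = node (A.sym e) (forest-sym p) ∷ forest-sym q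

  forest-trans : ∀ {s t u} → ForestEq A s t → ForestEq A t u → ForestEq A s u
  forest-trans []             []               = []
  forest-trans (node e p ∷ q) (node e′ p′ ∷ q′) =
    node (A.trans e e′) (forest-trans p p′) ∷ forest-trans q q′

  forest-reflexive : ∀ {s t} → s ≡ t → ForestEq A s t
  forest-reflexive ≡.refl = forest-refl

  context-refl : ∀ {p} → ContextEq A p p
  context-refl {hole l r}      = hole forest-refl forest-refl
  context-refl {below l a p r} = below forest-refl A.refl context-refl forest-refl

  context-sym : ∀ {p q} → ContextEq A p q → ContextEq A q p
  context-sym (hole l r)      = hole (forest-sym l) (forest-sym r)
  context-sym (below l a p r) =
    below (forest-sym l) (A.sym a) (context-sym p) (forest-sym r)

  context-trans : ∀ {p q r} → ContextEq A p q → ContextEq A q r → ContextEq A p r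
  context-trans (hole l r)      (hole l′ r′)        =
    hole (forest-trans l l′) (forest-trans r r′)
  context-trans (below l a p r) (below l′ a′ p′ r′) =
    below (forest-trans l l′) (A.trans a a′) (context-trans p p′) (forest-trans r r′)

  plug-cong : ∀ {p q s t} → ContextEq A p q → ForestEq A s t →
              ForestEq A (plug p s) (plug q t)
  plug-cong (hole l r)      e = Pointwise.++⁺ l (Pointwise.++⁺ e r)
  plug-cong (below l a p r) e = Pointwise.++⁺ l (node a (plug-cong p e) ∷ r)

  sizeT-cong : ∀ {t u} → TreeEq A t u → sizeT t ≡ sizeT u
  size-cong  : ∀ {s t} → ForestEq A s t → size s ≡ size t
  sizeT-cong (node _ p) = ≡.cong suc (size-cong p)
  size-cong []      = ≡.refl
  size-cong (p ∷ q) = ≡.cong₂ ℕ._+_ (sizeT-cong p) (size-cong q)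

  -- Substituting a tree t larger than everything to the left of the path
  -- to the hole in p and in q separates p from q.

  private
    smaller : ∀ {n} (t u : Tree A.Carrier) s → n < sizeT t → size (u ∷ s) ≤ n →
              sizeT u < sizeT t
    smaller t u s n<t u≤n =
      ℕ.≤-<-trans (ℕ.≤-trans (ℕ.m≤m+n (sizeT u) (size s)) u≤n) n<t

    tail≤ : ∀ (u : Tree A.Carrier) s {n} → size (u ∷ s) ≤ n → size s ≤ n
    tail≤ u s = ℕ.≤-trans (ℕ.m≤n+m (size s) (sizeT u))

    match : ∀ {n r r′} l x l′ y → size l ≤ n → size l′ ≤ n →
            n < sizeT x → n < sizeT y →
            ForestEq A (l ++ x ∷ r) (l′ ++ y ∷ r′) →
            ForestEq A l l′ × TreeEq A x y × ForestEq A r r′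
    match []      x []        y _   _    _   _   (e ∷ es) = [] , e , es
    match []      x (u ∷ l′)  y _   ul′≤ n<x _   (e ∷ _)  =
      ⊥-elim (ℕ.<-irrefl (≡.sym (sizeT-cong e)) (smaller x u l′ n<x ul′≤))
    match (u ∷ l) x []        y ul≤ _    _   n<y (e ∷ _)  =
      ⊥-elim (ℕ.<-irrefl (sizeT-cong e) (smaller y u l n<y ul≤))
    match (u ∷ l) x (u′ ∷ l′) y ul≤ ul′≤ n<x n<y (e ∷ es)
      with match l x l′ y (tail≤ u l ul≤) (tail≤ u′ l′ ul′≤) n<x n<y es
    ... | el , ex , er = e ∷ el , ex , er

    wrap : Tree A.Carrier → A.Carrier → Context A.Carrier → Tree A.Carrier
    wrap t a p = node a (plug p (t ∷ []))

    grow : ∀ t a p → sizeT t < sizeT (wrap t a p)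
    grow t a p =
      ℕ.s≤s (ℕ.≤-trans (ℕ.m≤m+n (sizeT t) 0) (size-plug p (t ∷ [])))

    grow′ : ∀ {n} t a p → n < sizeT t → n < sizeT (wrap t a p)
    grow′ {n} t a p n<t =
      ℕ.<-trans {n} {sizeT t} {sizeT (wrap t a p)} n<t (grow t a p)

    irrefl : ∀ {m n} → m ≡ n → m < n → ⊥
    irrefl = ℕ.<-irrefl

    separate : ∀ {n} t p q → n < sizeT t → sizeC p ≤ n → sizeC q ≤ n →
               ForestEq A (plug p (t ∷ [])) (plug q (t ∷ [])) → ContextEq A p q
    separate t (hole l r) (hole l′ r′) n<t p≤ q≤ e
      with match l t l′ t p≤ q≤ n<t n<t e
    ... | el , _ , er = hole el er
    separate t (hole l r) (below l′ b q r′) n<t p≤ q≤ e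
      with match l t l′ (wrap t b q) p≤ (ℕ.m+n≤o⇒m≤o (size l′) q≤)
                 n<t (grow′ t b q n<t) e
    ... | _ , ex , _ =
      ⊥-elim (irrefl {sizeT t} {sizeT (wrap t b q)} (sizeT-cong ex) (grow t b q))
    separate t (below l a p r) (hole l′ r′) n<t p≤ q≤ e
      with match l (wrap t a p) l′ t (ℕ.m+n≤o⇒m≤o (size l) p≤) q≤
                 (grow′ t a p n<t) n<t e
    ... | _ , ex , _ =
      ⊥-elim (irrefl {sizeT t} {sizeT (wrap t a p)} (≡.sym (sizeT-cong ex)) (grow t a p))
    separate t (below l a p r) (below l′ b q r′) n<t p≤ q≤ e
      with match l (wrap t a p) l′ (wrap t b q)
                 (ℕ.m+n≤o⇒m≤o (size l) p≤) (ℕ.m+n≤o⇒m≤o (size l′) q≤)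
                 (grow′ t a p n<t) (grow′ t b q n<t) e
    ... | el , node ea ep , er =
      below el ea
        (separate t p q n<t (ℕ.m+n≤o⇒n≤o (size l) p≤) (ℕ.m+n≤o⇒n≤o (size l′) q≤) ep)
        er

    separate′ : A.Carrier → ∀ p q →
                (∀ s → ForestEq A (plug p s) (plug q s)) → ContextEq A p q
    separate′ a p q e =
      separate t p q (size-tower a n)
        (ℕ.m≤m+n (sizeC p) (sizeC q)) (ℕ.m≤n+m (sizeC q) (sizeC p)) (e (t ∷ []))
      where
      n = sizeC p ℕ.+ sizeC q
      t = tower a n

  plug-faithful : ∀ {p q} → (∀ s → ForestEq A (plug p s) (plug q s)) → ContextEq A p q
  plug-faithful {p@(below _ a _ _)}           {q} e = separate′ a p q e
  plug-faithful {p@(hole (node a _ ∷ _) _)}   {q} e = separate′ a p q e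
  plug-faithful {p@(hole [] (node a _ ∷ _))}  {q} e = separate′ a p q e
  plug-faithful {p@(hole [] [])} {q@(below _ a _ _)}          e = separate′ a p q e
  plug-faithful {p@(hole [] [])} {q@(hole (node a _ ∷ _) _)}  e = separate′ a p q e
  plug-faithful {p@(hole [] [])} {q@(hole [] (node a _ ∷ _))} e = separate′ a p q e
  plug-faithful {hole [] []}     {hole [] []}                 e = hole [] []

module _ (A : Setoid 0ℓ 0ℓ) where
  private module A = Setoid A

  forestMonoid : Monoid 0ℓ 0ℓ
  forestMonoid = record
    { Carrier  = Forest A.Carrier
    ; _≈_      = ForestEq A
    ; _∙_      = _++_
    ; ε        = []
    ; isMonoid = record
      { isSemigroup = record
        { isMagma = record
          { isEquivalence = record
            { refl = forest-refl ; sym = forest-sym ; trans = forest-trans }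
          ; ∙-cong = Pointwise.++⁺
          }
        ; assoc = λ s t u → forest-reflexive (List.++-assoc s t u)
        }
      ; identity = (λ s → forest-refl)
                 , (λ s → forest-reflexive (List.++-identityʳ s))
      }
    }

  contextSetoid : Setoid 0ℓ 0ℓ
  contextSetoid = record
    { Carrier       = Context A.Carrier
    ; _≈_           = ContextEq A
    ; isEquivalence = record
      { refl = context-refl ; sym = context-sym ; trans = context-trans }
    }

  _^Δ : ForestAlgebra
  _^Δ = forestAlgebra forestMonoid contextSetoid
    compose (hole [] []) plug plug-cong
    (λ s → forest-reflexive (List.++-identityʳ s))
    (λ p q s → forest-reflexive (plug-compose p q s))
    plug-faithful
    (λ s → hole s []) (λ s → hole [] s)
    (λ s t → forest-reflexive (≡.cong (s ++_) (List.++-identityʳ t)))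
    (λ s t → forest-refl)

-- The context a□.

letter : {A : Set} → A → Context A
letter a = below [] a (hole [] []) []

------------------------------------------------------------------------
-- The homomorphism out of the free forest algebra with prescribed values
-- on the letters.

module _ {A : Setoid 0ℓ 0ℓ} (F : ForestAlgebra) (f : Func A (vSetoid F)) where
  private
    module A = Setoid A
    open ForestAlgebra F
    open SetoidReasoning H.setoid

  evalForest : Forest A.Carrier → H.Carrier
  evalForest []             = H.𝟘
  evalForest (node a s ∷ t) = (f ⟨$⟩ a) · evalForest s H.+ evalForest t

  evalContext : Context A.Carrier → V.Carrier
  evalContext (hole l r)      = inˡ (evalForest l) V.∘ inʳ (evalForest r)
  evalContext (below l a p r) =
    inˡ (evalForest l) V.∘ inʳ (evalForest r) V.∘ (f ⟨$⟩ a) V.∘ evalContext p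

  private
    evalForest-cong : ∀ {s t} → ForestEq A s t → evalForest s H.≈ evalForest t
    evalForest-cong []             = H.refl
    evalForest-cong (node e p ∷ q) =
      H.∙-cong (·-cong (Func.cong f e) (evalForest-cong p)) (evalForest-cong q)

    evalForest-++ : ∀ s t → evalForest (s ++ t) H.≈ evalForest s H.+ evalForest t
    evalForest-++ []             t = H.sym (H.identityˡ _)
    evalForest-++ (node a s ∷ u) t =
      H.trans (H.∙-congˡ (evalForest-++ u t)) (H.sym (H.assoc _ _ _))

    around-· : ∀ g h x → (inˡ g V.∘ inʳ h) · x H.≈ g H.+ (x H.+ h)
    around-· g h x = begin
      (inˡ g V.∘ inʳ h) · x  ≈⟨ ·-assoc _ _ _ ⟩
      inˡ g · inʳ h · x      ≈⟨ inˡ-· _ _ ⟩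
      g H.+ inʳ h · x        ≈⟨ H.∙-congˡ (inʳ-· _ _) ⟩
      g H.+ (x H.+ h)        ∎

    hole-· : ∀ l r x →
             evalContext (hole l r) · x H.≈ evalForest l H.+ (x H.+ evalForest r)
    hole-· l r x = around-· _ _ x

    below-· : ∀ l a p r x → evalContext (below l a p r) · x H.≈
              evalForest l H.+ ((f ⟨$⟩ a) · evalContext p · x H.+ evalForest r)
    below-· l a p r x = begin
      evalContext (below l a p r) · x
        ≈⟨ ·-assoc _ _ _ ⟩
      (inˡ (evalForest l) V.∘ inʳ (evalForest r) V.∘ (f ⟨$⟩ a)) · evalContext p · x
        ≈⟨ ·-assoc _ _ _ ⟩
      (inˡ (evalForest l) V.∘ inʳ (evalForest r)) · (f ⟨$⟩ a) · evalContext p · x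
        ≈⟨ around-· _ _ _ ⟩
      evalForest l H.+ ((f ⟨$⟩ a) · evalContext p · x H.+ evalForest r) ∎

    evalContext-cong : ∀ {p q} → ContextEq A p q → evalContext p V.≈ evalContext q
    evalContext-cong (hole {l} {l′} {r} {r′} el er) = faithful λ x → begin
      evalContext (hole l r) · x
        ≈⟨ hole-· l r x ⟩
      evalForest l H.+ (x H.+ evalForest r)
        ≈⟨ H.∙-cong (evalForest-cong el) (H.∙-congˡ (evalForest-cong er)) ⟩
      evalForest l′ H.+ (x H.+ evalForest r′)
        ≈⟨ hole-· l′ r′ x ⟨
      evalContext (hole l′ r′) · x ∎
    evalContext-cong (below {l} {l′} {a} {a′} {p} {p′} {r} {r′} el ea ep er) =
      faithful λ x → begin
      evalContext (below l a p r) · x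
        ≈⟨ below-· l a p r x ⟩
      evalForest l H.+ ((f ⟨$⟩ a) · evalContext p · x H.+ evalForest r)
        ≈⟨ H.∙-cong (evalForest-cong el)
             (H.∙-cong (·-cong (Func.cong f ea) (·-cong (evalContext-cong ep) H.refl))
                       (evalForest-cong er)) ⟩
      evalForest l′ H.+ ((f ⟨$⟩ a′) · evalContext p′ · x H.+ evalForest r′)
        ≈⟨ below-· l′ a′ p′ r′ x ⟨
      evalContext (below l′ a′ p′ r′) · x ∎

    regroup : ∀ l l′ x r′ r →
      evalForest (l ++ l′) H.+ (x H.+ evalForest (r′ ++ r)) H.≈
      evalForest l H.+ ((evalForest l′ H.+ (x H.+ evalForest r′)) H.+ evalForest r)
    regroup l l′ x r′ r = begin
      evalForest (l ++ l′) H.+ (x H.+ evalForest (r′ ++ r))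
        ≈⟨ H.∙-cong (evalForest-++ l l′) (H.∙-congˡ (evalForest-++ r′ r)) ⟩
      (L H.+ L′) H.+ (x H.+ (R′ H.+ R))
        ≈⟨ H.assoc _ _ _ ⟩
      L H.+ (L′ H.+ (x H.+ (R′ H.+ R)))
        ≈⟨ H.∙-congˡ (H.∙-congˡ (H.assoc _ _ _)) ⟨
      L H.+ (L′ H.+ ((x H.+ R′) H.+ R))
        ≈⟨ H.∙-congˡ (H.assoc _ _ _) ⟨
      L H.+ ((L′ H.+ (x H.+ R′)) H.+ R) ∎
      where
      L  = evalForest l
      L′ = evalForest l′
      R  = evalForest r
      R′ = evalForest r′

    surround-· : ∀ l p r x → evalContext (surround l p r) · x H.≈
                 evalForest l H.+ (evalContext p · x H.+ evalForest r)
    surround-· l (hole l′ r′) r x = begin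
      evalContext (hole (l ++ l′) (r′ ++ r)) · x
        ≈⟨ hole-· (l ++ l′) (r′ ++ r) x ⟩
      evalForest (l ++ l′) H.+ (x H.+ evalForest (r′ ++ r))
        ≈⟨ regroup l l′ x r′ r ⟩
      evalForest l H.+ ((evalForest l′ H.+ (x H.+ evalForest r′)) H.+ evalForest r)
        ≈⟨ H.∙-congˡ (H.∙-congʳ (hole-· l′ r′ x)) ⟨
      evalForest l H.+ (evalContext (hole l′ r′) · x H.+ evalForest r) ∎
    surround-· l (below l′ a p r′) r x = begin
      evalContext (below (l ++ l′) a p (r′ ++ r)) · x
        ≈⟨ below-· (l ++ l′) a p (r′ ++ r) x ⟩
      evalForest (l ++ l′) H.+ ((f ⟨$⟩ a) · evalContext p · x H.+ evalForest (r′ ++ r))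
        ≈⟨ regroup l l′ _ r′ r ⟩
      evalForest l H.+ ((evalForest l′ H.+ ((f ⟨$⟩ a) · evalContext p · x H.+ evalForest r′)) H.+ evalForest r)
        ≈⟨ H.∙-congˡ (H.∙-congʳ (below-· l′ a p r′ x)) ⟨
      evalForest l H.+ (evalContext (below l′ a p r′) · x H.+ evalForest r) ∎

    compose-· : ∀ p q x →
                evalContext (compose p q) · x H.≈ evalContext p · evalContext q · x
    compose-· (hole l r) q x =
      H.trans (surround-· l q r x) (H.sym (hole-· l r (evalContext q · x)))
    compose-· (below l a p r) q x = begin
      evalContext (below l a (compose p q) r) · x
        ≈⟨ below-· l a (compose p q) r x ⟩
      evalForest l H.+ ((f ⟨$⟩ a) · evalContext (compose p q) · x H.+ evalForest r)
        ≈⟨ H.∙-congˡ (H.∙-congʳ (·-cong V.refl (compose-· p q x))) ⟩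
      evalForest l H.+ ((f ⟨$⟩ a) · evalContext p · evalContext q · x H.+ evalForest r)
        ≈⟨ below-· l a p r (evalContext q · x) ⟨
      evalContext (below l a p r) · evalContext q · x ∎

    plug-· : ∀ p s → evalForest (plug p s) H.≈ evalContext p · evalForest s
    plug-· (hole l r) s = begin
      evalForest (l ++ s ++ r)
        ≈⟨ evalForest-++ l (s ++ r) ⟩
      evalForest l H.+ evalForest (s ++ r)
        ≈⟨ H.∙-congˡ (evalForest-++ s r) ⟩
      evalForest l H.+ (evalForest s H.+ evalForest r)
        ≈⟨ hole-· l r _ ⟨
      evalContext (hole l r) · evalForest s ∎
    plug-· (below l a p r) s = begin
      evalForest (l ++ node a (plug p s) ∷ r)
        ≈⟨ evalForest-++ l _ ⟩
      evalForest l H.+ ((f ⟨$⟩ a) · evalForest (plug p s) H.+ evalForest r)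
        ≈⟨ H.∙-congˡ (H.∙-congʳ (·-cong V.refl (plug-· p s))) ⟩
      evalForest l H.+ ((f ⟨$⟩ a) · evalContext p · evalForest s H.+ evalForest r)
        ≈⟨ below-· l a p r _ ⟨
      evalContext (below l a p r) · evalForest s ∎

  extend : Hom (A ^Δ) F
  extend = record
    { onH      = evalForest
    ; onV      = evalContext
    ; onH-homo = record
      { isMagmaHomomorphism = record
        { isRelHomomorphism = record { cong = evalForest-cong }
        ; homo              = evalForest-++
        }
      ; ε-homo = H.refl
      }
    ; onV-homo = record
      { isMagmaHomomorphism = record
        { isRelHomomorphism = record { cong = evalContext-cong }
        ; homo              = λ p q → faithful λ x →
            H.trans (compose-· p q x) (H.sym (·-assoc _ _ x))
        }
      ; ε-homo = faithful λ x → begin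
          evalContext (hole [] []) · x  ≈⟨ hole-· [] [] x ⟩
          H.𝟘 H.+ (x H.+ H.𝟘)           ≈⟨ H.identityˡ _ ⟩
          x H.+ H.𝟘                     ≈⟨ H.identityʳ x ⟩
          x                             ≈⟨ ·-identity x ⟨
          V.𝟙 · x                       ∎
      }
    ; ·-homo   = plug-·
    ; inˡ-homo = λ s → faithful λ x → begin
        evalContext (hole s []) · x     ≈⟨ hole-· s [] x ⟩
        evalForest s H.+ (x H.+ H.𝟘)    ≈⟨ H.∙-congˡ (H.identityʳ x) ⟩
        evalForest s H.+ x              ≈⟨ inˡ-· _ x ⟨
        inˡ (evalForest s) · x          ∎
    ; inʳ-homo = λ s → faithful λ x → begin
        evalContext (hole [] s) · x     ≈⟨ hole-· [] s x ⟩
        H.𝟘 H.+ (x H.+ evalForest s)    ≈⟨ H.identityˡ _ ⟩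
        x H.+ evalForest s              ≈⟨ inʳ-· _ x ⟨
        inʳ (evalForest s) · x          ∎
    }

------------------------------------------------------------------------
-- k-definiteness

Definite : ∀ {A F} → ℕ → Hom (A ^Δ) F → Set
Definite {A} {F} k α =
  ∀ (p : Context (Setoid.Carrier A)) → k ≤ depth p → ∀ s s′ →
  Hom.onH α (plug p s) F.H.≈ Hom.onH α (plug p s′)
  where module F = ForestAlgebra F

------------------------------------------------------------------------
-- The congruences ∼ₖ and the quotient homomorphisms

roots : {B : Set} → Forest B → List (B × Forest B)
roots = map (λ { (node b s) → b , s })

module _ (B : Setoid 0ℓ 0ℓ) where
  private module B = Setoid B

  -- T^{k+1}_s is the set of entries of roots s, taken in the setoid
  -- B × (forests modulo ∼ₖ).

  Sim               : ℕ → Forest B.Carrier → Forest B.Carrier → Set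
  Sim-isEquivalence : ∀ k → IsEquivalence (Sim k)
  Sim-setoid        : ℕ → Setoid 0ℓ 0ℓ

  Sim-setoid k = record
    { Carrier       = Forest B.Carrier
    ; _≈_           = Sim k
    ; isEquivalence = Sim-isEquivalence k
    }

  Sim zero    s s′ = ⊤
  Sim (suc k) s s′ = roots s ⊆ roots s′ × roots s′ ⊆ roots s
    where open Subset (B ×ₛ Sim-setoid k) using (_⊆_)

  Sim-isEquivalence zero    = _
  Sim-isEquivalence (suc k) = record
    { refl  = (λ m → m) , (λ m → m)
    ; sym   = λ (i , j) → (λ m → j m) , (λ m → i m)
    ; trans = λ (i , j) (i′ , j′) → (λ m → i′ (i m)) , (λ m → j (j′ m))
    }

module _ {B : Setoid 0ℓ 0ℓ} where
  private
    module B = Setoid B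
    module Sim k = IsEquivalence (Sim-isEquivalence B k)

    Pair : ℕ → Setoid 0ℓ 0ℓ
    Pair k = B ×ₛ Sim-setoid B k

    roots-++ : (s t : Forest B.Carrier) → roots (s ++ t) ≡ roots s ++ roots t
    roots-++ = List.map-++ _

    Sim-pointwise : ∀ k {s t} → Pointwise (Setoid._≈_ (Pair k)) (roots s) (roots t) →
                    Sim B (suc k) s t
    Sim-pointwise k e =
        Subsetₚ.⊆-reflexive (Pair k) e
      , Subsetₚ.⊆-reflexive (Pair k) (Pointwise.symmetric (Setoid.sym (Pair k)) e)

    representative : ∀ k {x} (s : Forest B.Carrier) →
      Any (Setoid._≈_ (Pair k) x) (roots s) →
      Σ[ y ∈ B.Carrier × Forest B.Carrier ]
        Any (Setoid._≈_ (Pair (suc k)) y) (roots s) × Setoid._≈_ (Pair k) x y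
    representative k (node b u ∷ s) (here e)  =
      (b , u) , here (Setoid.refl (Pair (suc k))) , e
    representative k (node b u ∷ s) (there m) with representative k s m
    ... | y , m′ , e = y , there m′ , e

  Sim-pred : ∀ k {s t} → Sim B (suc k) s t → Sim B k s t
  Sim-pred zero    _       = tt
  Sim-pred (suc k) {s} {t} (i , j) = weaken s t i , weaken t s j
    where
    open Subset (Pair k)       using () renaming (_⊆_ to _⊆₀_)
    open Subset (Pair (suc k)) using () renaming (_⊆_ to _⊆₁_)
    weaken : ∀ s t → roots s ⊆₁ roots t → roots s ⊆₀ roots t
    weaken s t i m with representative k s m
    ... | y , m′ , e =
      Any.map (λ (eb , eu) → Setoid.trans (Pair k) e (eb , Sim-pred k eu)) (i m′)

  Sim-++ : ∀ k {s s′ t t′} → Sim B k s s′ → Sim B k t t′ → Sim B k (s ++ t) (s′ ++ t′)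
  Sim-++ zero    _ _ = tt
  Sim-++ (suc k) {s} {s′} {t} {t′} (i , j) (i′ , j′)
    rewrite roots-++ s t | roots-++ s′ t′ =
    Subsetₚ.++⁺ (Pair k) i i′ , Subsetₚ.++⁺ (Pair k) j j′

  Sim-node : ∀ k a {s t} → Sim B k s t →
             Sim B (suc k) (node a s ∷ []) (node a t ∷ [])
  Sim-node k a e = Sim-pointwise k ((B.refl , e) ∷ [])

  Sim-plug : ∀ k p {s t} → Sim B k s t → Sim B k (plug p s) (plug p t)
  Sim-plug k (hole l r) e = Sim-++ k (Sim.refl k {l}) (Sim-++ k e (Sim.refl k {r}))
  Sim-plug zero    (below l a p r) e = tt
  Sim-plug (suc k) (below l a p r) {s} {t} e =
    Sim-++ (suc k) (Sim.refl (suc k) {l})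
      (Sim-++ (suc k) (Sim-node k a (Sim-plug k p (Sim-pred k {s} {t} e)))
                      (Sim.refl (suc k) {r}))

  ForestEq⇒Sim : ∀ k {s t} → ForestEq B s t → Sim B k s t
  ForestEq⇒Sim zero    _ = tt
  ForestEq⇒Sim (suc k) e = Sim-pointwise k (go e)
    where
    go : ∀ {s t} → ForestEq B s t → Pointwise (Setoid._≈_ (Pair k)) (roots s) (roots t)
    go []              = []
    go (node eb e ∷ es) = (eb , ForestEq⇒Sim k e) ∷ go es

module _ (B : Setoid 0ℓ 0ℓ) (k : ℕ) where
  private
    module B = Setoid B
    module Sim = IsEquivalence (Sim-isEquivalence B k)

    ≡⇒Sim : ∀ {s t} → s ≡ t → Sim B k s t
    ≡⇒Sim ≡.refl = Sim.refl

  -- Two contexts are identified when they act identically on ∼ₖ-classes,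
  -- so that the quotient acts faithfully.

  Free/∼ : ForestAlgebra
  Free/∼ = forestAlgebra
    record
      { Carrier  = Forest B.Carrier
      ; _≈_      = Sim B k
      ; _∙_      = _++_
      ; ε        = []
      ; isMonoid = record
        { isSemigroup = record
          { isMagma = record
            { isEquivalence = Sim-isEquivalence B k
            ; ∙-cong        = λ {s} {s′} {t} {t′} → Sim-++ k {s} {s′} {t} {t′}
            }
          ; assoc = λ s t u → ≡⇒Sim (List.++-assoc s t u)
          }
        ; identity = (λ s → Sim.refl) , (λ s → ≡⇒Sim (List.++-identityʳ s))
        }
      }
    record
      { Carrier       = Context B.Carrier
      ; _≈_           = λ p q → ∀ s → Sim B k (plug p s) (plug q s)
      ; isEquivalence = record
        { refl  = λ s → Sim.refl
        ; sym   = λ e s → Sim.sym (e s)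
        ; trans = λ e e′ s → Sim.trans (e s) (e′ s)
        }
      }
    compose (hole [] []) plug
    (λ {p} {q} {s} {t} p≈q s∼t → Sim.trans (Sim-plug k p s∼t) (p≈q t))
    (λ s → ≡⇒Sim (List.++-identityʳ s))
    (λ p q s → ≡⇒Sim (plug-compose p q s))
    (λ e → e)
    (λ s → hole s []) (λ s → hole [] s)
    (λ s t → ≡⇒Sim (≡.cong (s ++_) (List.++-identityʳ t)))
    (λ s t → Sim.refl)

  α∼ : Hom (B ^Δ) Free/∼
  α∼ = record
    { onH      = λ s → s
    ; onV      = λ p → p
    ; onH-homo = record
      { isMagmaHomomorphism = record
        { isRelHomomorphism = record { cong = ForestEq⇒Sim k }
        ; homo              = λ _ _ → Sim.refl
        }
      ; ε-homo = Sim.refl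
      }
    ; onV-homo = record
      { isMagmaHomomorphism = record
        { isRelHomomorphism = record
          { cong = λ e s → ForestEq⇒Sim k (plug-cong e forest-refl) }
        ; homo              = λ _ _ _ → Sim.refl
        }
      ; ε-homo = λ _ → Sim.refl
      }
    ; ·-homo   = λ _ _ → Sim.refl
    ; inˡ-homo = λ _ _ → Sim.refl
    ; inʳ-homo = λ _ _ → Sim.refl
    }

------------------------------------------------------------------------
-- Wreath products

infixl 6 _≀_

-- (v , f) (w , g) = (v w , h ↦ f (w h) ∘ g h), the composition forced by
-- the action.

_≀_ : ForestAlgebra → ForestAlgebra → ForestAlgebra
F ≀ G = forestAlgebra
  (DirectProduct.monoid F.horizontal G.horizontal)
  (vSetoid F ×ₛ FuncEquality.setoid (hSetoid F) (vSetoid G))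
  (λ (v , f) (w , g) → v F.V.∘ w , record
     { to   = λ h → (f ⟨$⟩ (w F.· h)) G.V.∘ (g ⟨$⟩ h)
     ; cong = λ e → G.V.∙-cong (Func.cong f (F.·-cong F.V.refl e)) (Func.cong g e)
     })
  (F.V.𝟙 , record { to = λ _ → G.V.𝟙 ; cong = λ _ → G.V.refl })
  (λ (v , f) (h₁ , h₂) → v F.· h₁ , (f ⟨$⟩ h₁) G.· h₂)
  (λ {(v , f)} {(w , g)} {(h₁ , h₂)} {(h₁′ , h₂′)} (v≈w , f≈g) (e₁ , e₂) →
      F.·-cong v≈w e₁
    , G.·-cong (G.V.trans (Func.cong f e₁) (f≈g h₁′)) e₂)
  (λ (h₁ , h₂) → F.·-identity h₁ , G.·-identity h₂)
  (λ (v , f) (w , g) (h₁ , h₂) → F.·-assoc v w h₁ , G.·-assoc _ _ h₂)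
  (λ e → F.faithful (λ h → proj₁ (e (h , G.H.𝟘)))
       , λ h₁ → G.faithful (λ h₂ → proj₂ (e (h₁ , h₂))))
  (λ (h₁ , h₂) → F.inˡ h₁ , record { to = λ _ → G.inˡ h₂ ; cong = λ _ → G.V.refl })
  (λ (h₁ , h₂) → F.inʳ h₁ , record { to = λ _ → G.inʳ h₂ ; cong = λ _ → G.V.refl })
  (λ (h₁ , h₂) (g₁ , g₂) → F.inˡ-· h₁ g₁ , G.inˡ-· h₂ g₂)
  (λ (h₁ , h₂) (g₁ , g₂) → F.inʳ-· h₁ g₁ , G.inʳ-· h₂ g₂)
  where
  module F = ForestAlgebra F
  module G = ForestAlgebra G

-- A letter a stands for the context a□, so its value lies in V.

onLetter : ∀ {A F} → Hom (A ^Δ) F → Func A (vSetoid F)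
onLetter α = record
  { to   = λ a → Hom.onV α (letter a)
  ; cong = λ e → MonoidMorphisms.IsMonoidHomomorphism.⟦⟧-cong (Hom.onV-homo α)
                   (below [] e (hole [] []) [])
  }

infixl 6 _⊗_

_⊗_ : ∀ {A F G} → Hom (A ^Δ) F → Hom ((A ×ₛ hSetoid F) ^Δ) G → Hom (A ^Δ) (F ≀ G)
_⊗_ {A} {F} {G} α β = extend (F ≀ G) record
  { to   = λ a → (onLetter α ⟨$⟩ a) , record
      { to   = λ h → onLetter β ⟨$⟩ (a , h)
      ; cong = λ e → Func.cong (onLetter β) (Setoid.refl A , e)
      }
  ; cong = λ e → Func.cong (onLetter α) e
               , λ h → Func.cong (onLetter β) (e , ForestAlgebra.H.refl F)
  }

-- IteratedWreath 𝒞 n γ: γ is β₁ ⊗ ⋯ ⊗ βₙ for 1-definite homomorphisms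
-- βᵢ : (A × H₁ × ⋯ × Hᵢ₋₁)^Δ → (Hᵢ , Vᵢ) with every (Hᵢ , Vᵢ) in 𝒞.

data IteratedWreath {c : Level} {A : Setoid 0ℓ 0ℓ} (𝒞 : ForestAlgebra → Set c) :
       ℕ → {F : ForestAlgebra} → Hom (A ^Δ) F → Set (lsuc 0ℓ ⊔ c) where
  first : ∀ {F} → 𝒞 F → (β : Hom (A ^Δ) F) → Definite 1 β →
          IteratedWreath 𝒞 1 β
  next  : ∀ {n F G} {γ : Hom (A ^Δ) F} → IteratedWreath 𝒞 n γ →
          𝒞 G → (β : Hom ((A ×ₛ hSetoid F) ^Δ) G) → Definite 1 β →
          IteratedWreath 𝒞 (suc n) (γ ⊗ β)

FactorsThroughIteratedWreath :
  ∀ {c : Level} {A F} → (ForestAlgebra → Set c) → ℕ → Hom (A ^Δ) F →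
  Set (lsuc 0ℓ ⊔ c)
FactorsThroughIteratedWreath {A = A} 𝒞 n α =
  Σ[ G ∈ ForestAlgebra ] Σ[ γ ∈ Hom (A ^Δ) G ]
    IteratedWreath 𝒞 n γ × α FactorsThrough γ

------------------------------------------------------------------------
-- The algebra U₂ and its powers

data U₂H : Set where
  𝟘 ∞ : U₂H

-- 𝟙 is the identity, c∞ (the vertical 0) and c₀ are the constant maps.

data U₂V : Set where
  𝟙 c∞ c₀ : U₂V

U₂ : ForestAlgebra
U₂ = forestAlgebra
  record
    { Carrier  = U₂H
    ; _≈_      = _≡_
    ; _∙_      = _+_
    ; ε        = 𝟘
    ; isMonoid = record
      { isSemigroup = record
        { isMagma = record
          { isEquivalence = ≡.isEquivalence
          ; ∙-cong        = ≡.cong₂ _+_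
          }
        ; assoc = λ { 𝟘 _ _ → ≡.refl ; ∞ _ _ → ≡.refl }
        }
      ; identity = (λ _ → ≡.refl) , (λ { 𝟘 → ≡.refl ; ∞ → ≡.refl })
      }
    }
  (≡.setoid U₂V) _∘_ 𝟙 _·_
  (≡.cong₂ _·_)
  (λ _ → ≡.refl)
  (λ { 𝟙 _ _ → ≡.refl ; c∞ _ _ → ≡.refl ; c₀ _ _ → ≡.refl })
  (λ {v} {w} e → faithful v w (e 𝟘) (e ∞))
  inˡ inˡ
  (λ { 𝟘 _ → ≡.refl ; ∞ _ → ≡.refl })
  (λ { 𝟘 𝟘 → ≡.refl ; 𝟘 ∞ → ≡.refl ; ∞ 𝟘 → ≡.refl ; ∞ ∞ → ≡.refl })
  where
  _+_ : U₂H → U₂H → U₂H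
  𝟘 + x = x
  ∞ + x = ∞
  _∘_ : U₂V → U₂V → U₂V
  𝟙  ∘ v = v
  c∞ ∘ v = c∞
  c₀ ∘ v = c₀
  _·_ : U₂V → U₂H → U₂H
  𝟙  · x = x
  c∞ · x = ∞
  c₀ · x = 𝟘
  inˡ : U₂H → U₂V
  inˡ 𝟘 = 𝟙
  inˡ ∞ = c∞
  faithful : ∀ v w → v · 𝟘 ≡ w · 𝟘 → v · ∞ ≡ w · ∞ → v ≡ w
  faithful 𝟙  𝟙  _  _  = ≡.refl
  faithful 𝟙  c∞ () _
  faithful 𝟙  c₀ _  ()
  faithful c∞ 𝟙  () _
  faithful c∞ c∞ _  _  = ≡.refl
  faithful c∞ c₀ () _
  faithful c₀ 𝟙  _  ()
  faithful c₀ c∞ () _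
  faithful c₀ c₀ _  _  = ≡.refl

directProduct : ForestAlgebra → ForestAlgebra → ForestAlgebra
directProduct F G = forestAlgebra
  (DirectProduct.monoid F.horizontal G.horizontal)
  (vSetoid F ×ₛ vSetoid G)
  (λ (v₁ , v₂) (w₁ , w₂) → v₁ F.V.∘ w₁ , v₂ G.V.∘ w₂)
  (F.V.𝟙 , G.V.𝟙)
  (λ (v₁ , v₂) (h₁ , h₂) → v₁ F.· h₁ , v₂ G.· h₂)
  (λ (d₁ , d₂) (e₁ , e₂) → F.·-cong d₁ e₁ , G.·-cong d₂ e₂)
  (λ (h₁ , h₂) → F.·-identity h₁ , G.·-identity h₂)
  (λ (v₁ , v₂) (w₁ , w₂) (h₁ , h₂) → F.·-assoc v₁ w₁ h₁ , G.·-assoc v₂ w₂ h₂)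
  (λ e → F.faithful (λ h → proj₁ (e (h , G.H.𝟘)))
       , G.faithful (λ h → proj₂ (e (F.H.𝟘 , h))))
  (λ (h₁ , h₂) → F.inˡ h₁ , G.inˡ h₂)
  (λ (h₁ , h₂) → F.inʳ h₁ , G.inʳ h₂)
  (λ (h₁ , h₂) (g₁ , g₂) → F.inˡ-· h₁ g₁ , G.inˡ-· h₂ g₂)
  (λ (h₁ , h₂) (g₁ , g₂) → F.inʳ-· h₁ g₁ , G.inʳ-· h₂ g₂)
  where
  module F = ForestAlgebra F
  module G = ForestAlgebra G

-- U₂^1+ m is the direct power with m + 1 factors.

U₂^1+_ : ℕ → ForestAlgebra
U₂^1+ zero  = U₂
U₂^1+ suc m = directProduct U₂ (U₂^1+ m)

IsU₂ : ForestAlgebra → Set (lsuc 0ℓ)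
IsU₂ F = F ≡ U₂

-- Each single factor U₂ of an iterated wreath product can raise the degree
-- of definiteness by one, while k-definite homomorphisms may need more than
-- k such factors.  For fixed k the factors U₂ therefore have to be grouped
-- into k levels, each one a direct product of copies of U₂.

IsPowerOfU₂ : ForestAlgebra → Set (lsuc 0ℓ)
IsPowerOfU₂ F = Σ[ m ∈ ℕ ] F ≡ U₂^1+ m

{-# OPTIONS --safe #-}

-- (a) ⇒ (b): if s ∼ⱼ s′ and p has depth at least k − j then α(ps) = α(ps′),
-- by induction on j.  For the step, every root bu of s′ can be replaced under
-- p by a root bu′ of s with u ∼ⱼ₋₁ u′, and then be absorbed by s since H is
-- idempotent and commutative; hence α(ps) = α(p(s + s′)) = α(ps′).
--
-- (c) ⇒ (b): γ ⊗ β sends s to (γ s , β ŝ), where ŝ is s with every node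
-- relabelled by the pair of its label and the value under γ of the forest
-- below it.  If γ factors through ∼ₙ, the root labels of ŝ, and hence β ŝ,
-- depend only on the ∼ₙ₊₁-class of s.
--
-- (b) ⇒ (d): over a finite alphabet a power of U₂ with one coordinate per
-- letter records the set of root labels.  Wreathing with it turns a γ that
-- separates ∼ₙ-classes into one that separates ∼ₙ₊₁-classes.  The coordinates
-- may also be added one at a time, each reading only the original H.

module Submission where

open import Defs
open import Level using (0ℓ)
open import Algebra.Definitions using (Commutative; Idempotent)
open import Algebra.Morphism.Structures using (module MonoidMorphisms)
open import Data.Empty using (⊥-elim)
open import Data.Fin.Base using (Fin; zero; suc)
import Data.Fin.Properties as Fin
open import Data.List.Base using ([]; _∷_; _++_; map)
import Data.List.Properties as List
open import Data.List.Relation.Unary.All as All using (All)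
import Data.List.Relation.Unary.All.Properties as All
open import Data.List.Relation.Unary.Any as Any using (Any; here; there)
import Data.List.Relation.Unary.Any.Properties as Any
open import Data.List.Relation.Binary.Pointwise using ([]; _∷_)
import Data.List.Membership.Setoid.Properties as Membership
open import Data.Nat using (ℕ; zero; suc; _+_; _≤_; _<_; z≤n; s≤s)
import Data.Nat.Properties as ℕ
open import Data.Product using (_×_; ∃-syntax; Σ-syntax; _,_; proj₁; proj₂)
open import Data.Product.Function.NonDependent.Setoid using (_×-inverse_)
open import Data.Product.Relation.Binary.Pointwise.NonDependent using (_×ₛ_; Pointwise-≡↔≡)
open import Data.Unit.Base using (tt)
open import Function.Base using (_∘_)
open import Function.Bundles using (_⇔_; mk⇔; Func; _⟨$⟩_; Inverse)
import Function.Construct.Composition as Compose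
import Function.Construct.Symmetry as Symmetry
open import Relation.Binary.Bundles using (Setoid)
open import Relation.Binary.PropositionalEquality as ≡ using (_≡_)
import Relation.Binary.Reasoning.Setoid as SetoidReasoning
open import Relation.Nullary using (yes; no)

private variable
  A B : Setoid 0ℓ 0ℓ
  F G : ForestAlgebra

Forestₛ : Setoid 0ℓ 0ℓ → Set
Forestₛ A = Forest (Setoid.Carrier A)

-- Identities for homomorphisms out of a free forest algebra

module HomProperties {A : Setoid 0ℓ 0ℓ} {F : ForestAlgebra} (α : Hom (A ^Δ) F) where
  open Hom α public using (onH; onV)
  open ForestAlgebra F
  private module M = MonoidMorphisms.IsMonoidHomomorphism (Hom.onH-homo α)

  onH-cong : ∀ {s t} → ForestEq A s t → onH s H.≈ onH t
  onH-cong = M.⟦⟧-cong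

  onH-≡ : ∀ {s t} → s ≡ t → onH s H.≈ onH t
  onH-≡ ≡.refl = H.refl

  onH-++ : ∀ s t → onH (s ++ t) H.≈ onH s H.+ onH t
  onH-++ = M.homo

  onH-[] : onH [] H.≈ H.𝟘
  onH-[] = M.ε-homo

  onH-∷ : ∀ a s t → onH (node a s ∷ t) H.≈ onV (letter a) · onH s H.+ onH t
  onH-∷ a s t = H.trans (onH-++ (node a s ∷ []) t) (H.∙-congʳ (H.trans
    -- `plug (letter a) s` unfolds to a single tree over `s ++ []`, hence the right unit law.
    (onH-≡ (≡.cong (λ x → node a x ∷ []) (≡.sym (List.++-identityʳ s))))
    (Hom.·-homo α (letter a) s)))

  onH-plug : ∀ p {s t} → onH s H.≈ onH t → onH (plug p s) H.≈ onH (plug p t)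
  onH-plug p {s} {t} e = begin
    onH (plug p s)   ≈⟨ Hom.·-homo α p s ⟩
    onV p · onH s    ≈⟨ ·-cong V.refl e ⟩
    onV p · onH t    ≈⟨ Hom.·-homo α p t ⟨
    onH (plug p t)   ∎
    where open SetoidReasoning H.setoid

-- The inclusion of T^{k+1}_s in T^{k+1}_t, tested on representatives only.

TypesIn : ∀ A → ℕ → Forestₛ A → Forestₛ A → Set
TypesIn A k s t =
  All (λ x → Any (Setoid._≈_ (A ×ₛ Sim-setoid A k) x) (roots t)) (roots s)

module _ {A : Setoid 0ℓ 0ℓ} (k : ℕ) where
  private Pair = A ×ₛ Sim-setoid A k

  Sim⇒TypesIn : ∀ {s t} → Sim A (suc k) s t → TypesIn A k s t × TypesIn A k t s
  Sim⇒TypesIn (i , j) = All.tabulateₛ Pair i , All.tabulateₛ Pair j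

  TypesIn⇒Sim : ∀ {s t} → TypesIn A k s t → TypesIn A k t s → Sim A (suc k) s t
  TypesIn⇒Sim i j =
      All.lookupₛ Pair (Membership.∈-resp-≈ Pair) i
    , All.lookupₛ Pair (Membership.∈-resp-≈ Pair) j

-- Definiteness and ∼ₖ

depth-compose : ∀ {X : Set} (p q : Context X) → depth (compose p q) ≡ depth p + depth q
depth-compose (hole l r) (hole l′ r′)      = ≡.refl
depth-compose (hole l r) (below l′ a q r′) = ≡.refl
depth-compose (below l a p r) q            = ≡.cong suc (depth-compose p q)

-- Lets the forest below a root be replaced: it becomes the filling of a context one level deeper
-- than `p`.
plug-node : ∀ {X : Set} (p : Context X) s b u t →
            plug (compose p (below s b (hole [] []) t)) u ≡ plug p (s ++ node b u ∷ t)
plug-node p s b u t = ≡.trans (plug-compose p _ u)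
  (≡.cong (λ x → plug p (s ++ node b x ∷ t)) (List.++-identityʳ u))

-- Each node on the path to the hole uses up one level of the equivalence, and at level 0 all
-- fillings are identified. This is what gives (b) ⇒ (a).
Sim-plug-deep : ∀ k p → k ≤ depth p → ∀ s t → Sim A k (plug p s) (plug p t)
Sim-plug-deep zero p _ s t = tt
Sim-plug-deep {A} (suc k) (below l a p r) (s≤s k≤p) s t =
  Sim-++ {A} (suc k) {l} {l} (Sim.refl {l})
    (Sim-++ {A} (suc k) {node a (plug p s) ∷ []} {node a (plug p t) ∷ []} {r} {r}
      (Sim-node k a (Sim-plug-deep k p k≤p s t)) (Sim.refl {r}))
  where module Sim = Setoid (Sim-setoid A (suc k))

factorsThrough∼⇒definite : ∀ k (α : Hom (A ^Δ) F) → α FactorsThrough α∼ A k → Definite k α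
factorsThrough∼⇒definite k α factors p k≤p s t = factors _ _ (Sim-plug-deep k p k≤p s t)

module _ {A : Setoid 0ℓ 0ℓ} {F : ForestAlgebra} (α : Hom (A ^Δ) F)
         (comm : Commutative (ForestAlgebra.H._≈_ F) (ForestAlgebra.H._+_ F))
         (idem : Idempotent (ForestAlgebra.H._≈_ F) (ForestAlgebra.H._+_ F)) where
  private
    module A = Setoid A
    open ForestAlgebra F
    open HomProperties α
    open SetoidReasoning H.setoid

    -- The forest `u′` is taken from below the matching root of `s`. The tree `b u′` then has the
    -- value of a summand already present in `s`, so adding it changes nothing.
    absorb-root : ∀ j {b u} s → Any (Setoid._≈_ (A ×ₛ Sim-setoid A j) (b , u)) (roots s) →
      ∃[ u′ ] (Sim A j u u′ × onH s H.+ onH (node b u′ ∷ []) H.≈ onH s)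
    absorb-root j {b} (node b′ u′ ∷ t) (here (b≈b′ , u∼u′)) = u′ , u∼u′ , (begin
      onH (node b′ u′ ∷ t) H.+ x   ≈⟨ H.∙-congʳ split ⟩
      (x H.+ onH t) H.+ x          ≈⟨ H.∙-congʳ (comm _ _) ⟩
      (onH t H.+ x) H.+ x          ≈⟨ H.assoc _ _ _ ⟩
      onH t H.+ (x H.+ x)          ≈⟨ H.∙-congˡ (idem x) ⟩
      onH t H.+ x                  ≈⟨ comm _ _ ⟩
      x H.+ onH t                  ≈⟨ split ⟨
      onH (node b′ u′ ∷ t)         ∎)
      where
      x = onH (node b u′ ∷ [])
      split : onH (node b′ u′ ∷ t) H.≈ x H.+ onH t
      split = H.trans (onH-++ (node b′ u′ ∷ []) t)
                (H.∙-congʳ (onH-cong (node (A.sym b≈b′) forest-refl ∷ [])))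
    absorb-root j {b} (v ∷ t) (there m) with absorb-root j t m
    ... | u′ , u∼u′ , e = u′ , u∼u′ , (begin
      onH (v ∷ t) H.+ x                ≈⟨ H.∙-congʳ (onH-++ (v ∷ []) t) ⟩
      (onH (v ∷ []) H.+ onH t) H.+ x   ≈⟨ H.assoc _ _ _ ⟩
      onH (v ∷ []) H.+ (onH t H.+ x)   ≈⟨ H.∙-congˡ e ⟩
      onH (v ∷ []) H.+ onH t           ≈⟨ onH-++ (v ∷ []) t ⟨
      onH (v ∷ t)                      ∎)
      where x = onH (node b u′ ∷ [])

    module _ (k : ℕ) (definite : Definite k α) where

      Sim⇒≈ : ∀ j p {s t} → k ≤ depth p + j → Sim A j s t →
              onH (plug p s) H.≈ onH (plug p t)
      -- The roots of `t` are removed one at a time. Passing below a root deepens the context by one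
      -- while the level drops from `suc j` to `j`, which preserves the bound.
      absorb : ∀ j p {s} t → k ≤ depth p + suc j → TypesIn A j t s →
               onH (plug p (s ++ t)) H.≈ onH (plug p s)

      Sim⇒≈ zero    p {s} {t} k≤ _ = definite p (≡.subst (k ≤_) (ℕ.+-identityʳ _) k≤) s t
      Sim⇒≈ (suc j) p {s} {t} k≤ s∼t with Sim⇒TypesIn {A} j {s} {t} s∼t
      ... | s⊑t , t⊑s = begin
        onH (plug p s)         ≈⟨ absorb j p t k≤ t⊑s ⟨
        onH (plug p (s ++ t))  ≈⟨ onH-plug p (H.trans (onH-++ s t) (H.trans (comm _ _) (H.sym (onH-++ t s)))) ⟩
        onH (plug p (t ++ s))  ≈⟨ absorb j p s k≤ s⊑t ⟩
        onH (plug p t)         ∎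

      absorb j p {s} [] k≤ _ = onH-≡ (≡.cong (plug p) (List.++-identityʳ s))
      absorb j p {s} (node b u ∷ t) k≤ (m All.∷ t⊑s) with absorb-root j s m
      ... | u′ , u∼u′ , e = begin
        onH (plug p (s ++ node b u ∷ t))   ≈⟨ onH-≡ (plug-node p s b u t) ⟨
        onH (plug q u)                     ≈⟨ Sim⇒≈ j q k≤q u∼u′ ⟩
        onH (plug q u′)                    ≈⟨ onH-≡ (plug-node p s b u′ t) ⟩
        onH (plug p (s ++ node b u′ ∷ t))  ≈⟨ onH-plug p absorbed ⟩
        onH (plug p (s ++ t))              ≈⟨ absorb j p t k≤ t⊑s ⟩
        onH (plug p s)                     ∎
        where
        q = compose p (below s b (hole [] []) t)
        x = onH (node b u′ ∷ [])
        k≤q : k ≤ depth q + j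
        k≤q = ≡.subst (k ≤_)
          (≡.trans (≡.sym (ℕ.+-assoc (depth p) 1 j))
                   (≡.cong (_+ j) (≡.sym (depth-compose p (below s b (hole [] []) t))))) k≤
        absorbed : onH (s ++ node b u′ ∷ t) H.≈ onH (s ++ t)
        absorbed = begin
          onH (s ++ node b u′ ∷ t)     ≈⟨ onH-++ s _ ⟩
          onH s H.+ onH (node b u′ ∷ t) ≈⟨ H.∙-congˡ (onH-++ (node b u′ ∷ []) t) ⟩
          onH s H.+ (x H.+ onH t)      ≈⟨ H.assoc _ _ _ ⟨
          (onH s H.+ x) H.+ onH t      ≈⟨ H.∙-congʳ e ⟩
          onH s H.+ onH t              ≈⟨ onH-++ s t ⟨
          onH (s ++ t)                 ∎

  definite⇒factorsThrough∼ : ∀ k → Definite k α → α FactorsThrough α∼ A k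
  definite⇒factorsThrough∼ k definite s t s∼t = begin
    onH s                        ≈⟨ onH-≡ (List.++-identityʳ s) ⟨
    -- The trivial context has depth 0, so level `k` meets the bound with equality.
    onH (plug (hole [] []) s)    ≈⟨ Sim⇒≈ k definite k (hole [] []) ℕ.≤-refl s∼t ⟩
    onH (plug (hole [] []) t)    ≈⟨ onH-≡ (List.++-identityʳ t) ⟩
    onH t                        ∎

-- Wreath products and relabelling

module _ {A : Setoid 0ℓ 0ℓ} {F : ForestAlgebra} (γ : Hom (A ^Δ) F) where
  private
    open HomProperties γ
    module A = Setoid A
    module F = ForestAlgebra F
    A×H = A ×ₛ hSetoid F

  -- This is ŝ of the outline.
  relabel : Forestₛ A → Forestₛ A×H
  relabel []             = []
  relabel (node a s ∷ t) = node (a , onH s) (relabel s) ∷ relabel t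

  roots-relabel : ∀ s →
    roots (relabel s) ≡ map (λ (a , u) → (a , onH u) , relabel u) (roots s)
  roots-relabel []             = ≡.refl
  roots-relabel (node a s ∷ t) = ≡.cong (_ ∷_) (roots-relabel t)

  module _ (k : ℕ) where

    -- At level 1 only root labels count. A root `a u` of `s` becomes a root labelled `(a , γ u)`,
    -- and the ∼ₖ-class of `u` fixes `γ u`.
    relabel-Sim⁺ : γ FactorsThrough α∼ A k → ∀ s t →
                   Sim A (suc k) s t → Sim A×H 1 (relabel s) (relabel t)
    relabel-Sim⁺ factors s t s∼t =
      let s⊑t , t⊑s = Sim⇒TypesIn {A} k {s} {t} s∼t in TypesIn⇒Sim {A×H} 0 (go s t s⊑t) (go t s t⊑s)
      where
      go : ∀ s t → TypesIn A k s t → TypesIn A×H 0 (relabel s) (relabel t)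
      go s t s⊑t rewrite roots-relabel s | roots-relabel t =
        All.map⁺ (All.map (λ m → Any.map⁺ (Any.map (λ (e , u∼v) → (e , factors _ _ u∼v) , tt) m)) s⊑t)

    -- Conversely, if `γ` separates ∼ₖ-classes, the label `(a , γ u)` recovers the class of `u`.
    relabel-Sim⁻ : α∼ A k FactorsThrough γ → ∀ s t →
                   Sim A×H 1 (relabel s) (relabel t) → Sim A (suc k) s t
    relabel-Sim⁻ separates s t s∼t =
      let s⊑t , t⊑s = Sim⇒TypesIn {A×H} 0 {relabel s} {relabel t} s∼t
      in TypesIn⇒Sim {A} k (go s t s⊑t) (go t s t⊑s)
      where
      go : ∀ s t → TypesIn A×H 0 (relabel s) (relabel t) → TypesIn A k s t
      go s t s⊑t rewrite roots-relabel s | roots-relabel t =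
        All.map (λ m → Any.map (λ ((e , u≈v) , _) → e , separates _ _ u≈v) (Any.map⁻ m)) (All.map⁻ s⊑t)

  module _ {G : ForestAlgebra} (β : Hom (A×H ^Δ) G) where
    private
      module β = HomProperties β
      module G = ForestAlgebra G
      module F≀G = ForestAlgebra (F ≀ G)

    -- At a node `a s` the function component of the letter is evaluated at the first coordinate of
    -- the value of `s`, which is `γ s`; so `β` reads the label `(a , γ s)`.
    onH-⊗ : ∀ s → Hom.onH (γ ⊗ β) s F≀G.H.≈ (onH s , β.onH (relabel s))
    onH-⊗ []             = F.H.sym onH-[] , G.H.sym β.onH-[]
    onH-⊗ (node a s ∷ t) with onH-⊗ s | onH-⊗ t
    ... | s₁ , s₂ | t₁ , t₂ =
        F.H.trans (F.H.∙-cong (F.·-cong F.V.refl s₁) t₁) (F.H.sym (onH-∷ a s t))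
      , G.H.trans
          (G.H.∙-cong (G.·-cong (Func.cong (onLetter β) (A.refl , s₁)) s₂) t₂)
          (G.H.sym (β.onH-∷ (a , onH s) (relabel s) (relabel t)))

    ⊗-≈⁺ : ∀ s t → onH s F.H.≈ onH t → β.onH (relabel s) G.H.≈ β.onH (relabel t) →
           Hom.onH (γ ⊗ β) s F≀G.H.≈ Hom.onH (γ ⊗ β) t
    ⊗-≈⁺ s t e₁ e₂ = F≀G.H.trans (onH-⊗ s) (F≀G.H.trans (e₁ , e₂) (F≀G.H.sym (onH-⊗ t)))

    ⊗-≈⁻ : ∀ s t → Hom.onH (γ ⊗ β) s F≀G.H.≈ Hom.onH (γ ⊗ β) t →
           (onH s F.H.≈ onH t) × (β.onH (relabel s) G.H.≈ β.onH (relabel t))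
    ⊗-≈⁻ s t e = F≀G.H.trans (F≀G.H.sym (onH-⊗ s)) (F≀G.H.trans e (onH-⊗ t))

-- A 1-definite factor sees only root labels, so by relabelling each further factor costs one level
-- of ∼.
wreath⇒factorsThrough∼ : ∀ {k} {γ : Hom (A ^Δ) F} →
  IteratedWreath IsFiniteForestAlgebra k γ → γ FactorsThrough α∼ A k
wreath⇒factorsThrough∼ (first fin β definite) =
  definite⇒factorsThrough∼ β (+-comm fin) (+-idempotent fin) 1 definite
  where open IsFiniteForestAlgebra
wreath⇒factorsThrough∼ (next {n = n} {γ = γ} wreath fin β definite) s t s∼t =
  -- The first coordinate already follows from level `n`; the second uses all of level `suc n`.
  ⊗-≈⁺ γ β s t (factors s t (Sim-pred n {s} {t} s∼t))
    (definite⇒factorsThrough∼ β (+-comm fin) (+-idempotent fin) 1 definite _ _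
      (relabel-Sim⁺ γ n factors s t s∼t))
  where
  open IsFiniteForestAlgebra
  factors = wreath⇒factorsThrough∼ wreath

wreath-map : ∀ {c d} {𝒞 : ForestAlgebra → Set c} {𝒟 : ForestAlgebra → Set d} →
  (∀ {G} → 𝒞 G → 𝒟 G) → ∀ {k} {γ : Hom (A ^Δ) F} →
  IteratedWreath 𝒞 k γ → IteratedWreath 𝒟 k γ
wreath-map f (first c β definite)  = first (f c) β definite
wreath-map f (next w c β definite) = next (wreath-map f w) (f c) β definite

wreath-positive : ∀ {c} {𝒞 : ForestAlgebra → Set c} {k} {γ : Hom (A ^Δ) F} →
  IteratedWreath 𝒞 k γ → 0 < k
wreath-positive (first _ _ _)  = s≤s z≤n
wreath-positive (next _ _ _ _) = s≤s z≤n

-- Homomorphisms sending letters to constant maps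

ConstantLetters : (F : ForestAlgebra) → Func A (vSetoid F) → Set
ConstantLetters F f = ∀ a x y → (f ⟨$⟩ a) · x H.≈ (f ⟨$⟩ a) · y
  where open ForestAlgebra F

-- A hole of positive depth lies below some root, and the constant map of that root's letter erases
-- the filling.
constantLetters⇒definite : (f : Func A (vSetoid F)) →
  ConstantLetters F f → Definite 1 (extend F f)
constantLetters⇒definite {F = F} f const (below l a p r) _ s t = begin
  onH (l ++ node a (plug p s) ∷ r)            ≈⟨ onH-++ l _ ⟩
  onH l H.+ onH (node a (plug p s) ∷ r)       ≈⟨ H.∙-congˡ (H.∙-congʳ (const a _ _)) ⟩
  onH l H.+ onH (node a (plug p t) ∷ r)       ≈⟨ onH-++ l _ ⟨
  onH (l ++ node a (plug p t) ∷ r)            ∎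
  where
  open ForestAlgebra F
  open HomProperties (extend F f)
  open SetoidReasoning H.setoid

pair : Func B (vSetoid F) → Func B (vSetoid G) → Func B (vSetoid (directProduct F G))
pair f g = record
  { to   = λ b → (f ⟨$⟩ b) , (g ⟨$⟩ b)
  ; cong = λ e → Func.cong f e , Func.cong g e
  }

-- The operations of a direct product are componentwise, so the equality is propositional and can
-- serve as a rewrite rule.
evalForest-pair : (f : Func B (vSetoid F)) (g : Func B (vSetoid G)) → ∀ s →
  evalForest (directProduct F G) (pair {B} {F} {G} f g) s ≡ (evalForest F f s , evalForest G g s)
evalForest-pair f g [] = ≡.refl
evalForest-pair {B} {F} {G} f g (node b s ∷ t)
  rewrite evalForest-pair {B} {F} {G} f g s | evalForest-pair {B} {F} {G} f g t = ≡.refl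

tuple : ∀ m → (Fin (suc m) → Func B (vSetoid U₂)) → Func B (vSetoid (U₂^1+ m))
tuple zero    f = f zero
tuple {B} (suc m) f = pair {B} {U₂} {U₂^1+ m} (f zero) (tuple m (f ∘ suc))

tuple-constantLetters : ∀ m (f : Fin (suc m) → Func B (vSetoid U₂)) →
  (∀ i → ConstantLetters U₂ (f i)) → ConstantLetters (U₂^1+ m) (tuple m f)
tuple-constantLetters zero    f const = const zero
tuple-constantLetters (suc m) f const a x y =
  const zero a (proj₁ x) (proj₁ y) , tuple-constantLetters m (f ∘ suc) (const ∘ suc) a (proj₂ x) (proj₂ y)

evalForest-tuple : ∀ m (f : Fin (suc m) → Func B (vSetoid U₂)) s t →
  ForestAlgebra.H._≈_ (U₂^1+ m) (evalForest (U₂^1+ m) (tuple m f) s) (evalForest (U₂^1+ m) (tuple m f) t) →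
  ∀ i → evalForest U₂ (f i) s ≡ evalForest U₂ (f i) t
evalForest-tuple zero    f s t e zero = e
evalForest-tuple {B} (suc m) f s t e i
  rewrite evalForest-pair {B} {U₂} {U₂^1+ m} (f zero) (tuple m (f ∘ suc)) s
        | evalForest-pair {B} {U₂} {U₂^1+ m} (f zero) (tuple m (f ∘ suc)) t
  with i
... | zero  = proj₁ e
... | suc i = evalForest-tuple m (f ∘ suc) s t (proj₂ e) i

-- Finiteness

Finite-× : Finite A → Finite B → Finite (A ×ₛ B)
Finite-× (m , i) (n , j) = _ , Compose.inverse (i ×-inverse j)
  (Compose.inverse Pointwise-≡↔≡ (Symmetry.inverse (Fin.*↔× {m} {n})))

-- The horizontal part of a wreath product is the plain product, and it is what enters the alphabet
-- of the next factor.
≀-finite : Finite (hSetoid F) → Finite (hSetoid G) → Finite (hSetoid (F ≀ G))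
≀-finite = Finite-×

U₂H-finite : Finite (≡.setoid U₂H)
U₂H-finite = 2 , record
  { to        = λ { 𝟘 → zero ; ∞ → suc zero }
  ; from      = λ { zero → 𝟘 ; (suc zero) → ∞ }
  ; to-cong   = ≡.cong _
  ; from-cong = ≡.cong _
  ; inverse   = (λ { {zero} ≡.refl → ≡.refl ; {suc zero} ≡.refl → ≡.refl })
              , (λ { {𝟘} ≡.refl → ≡.refl ; {∞} ≡.refl → ≡.refl })
  }

U₂V-finite : Finite (≡.setoid U₂V)
U₂V-finite = 3 , record
  { to        = λ { 𝟙 → zero ; c∞ → suc zero ; c₀ → suc (suc zero) }
  ; from      = λ { zero → 𝟙 ; (suc zero) → c∞ ; (suc (suc zero)) → c₀ }
  ; to-cong   = ≡.cong _
  ; from-cong = ≡.cong _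
  ; inverse   =
      (λ { {zero} ≡.refl → ≡.refl ; {suc zero} ≡.refl → ≡.refl ; {suc (suc zero)} ≡.refl → ≡.refl })
    , (λ { {𝟙} ≡.refl → ≡.refl ; {c∞} ≡.refl → ≡.refl ; {c₀} ≡.refl → ≡.refl })
  }

U₂-isFinite : IsFiniteForestAlgebra U₂
U₂-isFinite = record
  { H-finite     = U₂H-finite
  ; V-finite     = U₂V-finite
  ; +-comm       = λ { 𝟘 𝟘 → ≡.refl ; 𝟘 ∞ → ≡.refl ; ∞ 𝟘 → ≡.refl ; ∞ ∞ → ≡.refl }
  ; +-idempotent = λ { 𝟘 → ≡.refl ; ∞ → ≡.refl }
  }

directProduct-isFinite : IsFiniteForestAlgebra F → IsFiniteForestAlgebra G →
                         IsFiniteForestAlgebra (directProduct F G)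
directProduct-isFinite f g = record
  { H-finite     = Finite-× f.H-finite g.H-finite
  ; V-finite     = Finite-× f.V-finite g.V-finite
  ; +-comm       = λ (x₁ , x₂) (y₁ , y₂) → f.+-comm x₁ y₁ , g.+-comm x₂ y₂
  ; +-idempotent = λ (x₁ , x₂) → f.+-idempotent x₁ , g.+-idempotent x₂
  }
  where
  module f = IsFiniteForestAlgebra f
  module g = IsFiniteForestAlgebra g

U₂^-isFinite : ∀ m → IsFiniteForestAlgebra (U₂^1+ m)
U₂^-isFinite zero    = U₂-isFinite
U₂^-isFinite (suc m) = directProduct-isFinite U₂-isFinite (U₂^-isFinite m)

isPowerOfU₂⇒isFinite : IsPowerOfU₂ F → IsFiniteForestAlgebra F
isPowerOfU₂⇒isFinite (m , ≡.refl) = U₂^-isFinite m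

isU₂⇒isFinite : IsU₂ F → IsFiniteForestAlgebra F
isU₂⇒isFinite ≡.refl = U₂-isFinite

-- Recording root labels in copies of U₂

-- Every forest evaluates to `𝟘`; this fills a place where some factor must stand but nothing is to
-- be recorded.
c₀-letters : Func B (vSetoid U₂)
c₀-letters = record { to = λ _ → c₀ ; cong = λ _ → ≡.refl }

module _ {B : Setoid 0ℓ 0ℓ} (finite : Finite B) where
  private
    module B = Setoid B
    n = proj₁ finite
    open Inverse (proj₂ finite) using (to; to-cong; from-cong; strictlyInverseʳ)

    -- Unmarked letters go to `c₀` rather than `𝟙`, so that occurrences of the marked letter
    -- strictly below a root are forgotten.
    mark : Fin n → Fin n → U₂V
    mark i j with i Fin.≟ j
    ... | yes _ = c∞
    ... | no  _ = c₀

    mark-constant : ∀ i j x y → ForestAlgebra._·_ U₂ (mark i j) x ≡ ForestAlgebra._·_ U₂ (mark i j) y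
    mark-constant i j x y with i Fin.≟ j
    ... | yes _ = ≡.refl
    ... | no  _ = ≡.refl

  indicator : Fin (proj₁ finite) → Func B (vSetoid U₂)
  indicator i = record { to = λ b → mark i (to b) ; cong = λ e → ≡.cong (mark i) (to-cong e) }

  indicator-constantLetters : ∀ i → ConstantLetters U₂ (indicator i)
  indicator-constantLetters i b = mark-constant i (to b)

  private
    HasRoot : Fin n → Forest B.Carrier → Set
    HasRoot i s = Any (λ x → i ≡ to (proj₁ x)) (roots s)

    hasRoot⇒∞ : ∀ i s → HasRoot i s → evalForest U₂ (indicator i) s ≡ ∞
    hasRoot⇒∞ i (node b u ∷ s) m with i Fin.≟ to b | m
    ... | yes _   | _       = ≡.refl
    ... | no i≢b  | here e  = ⊥-elim (i≢b e)
    ... | no _    | there m = hasRoot⇒∞ i s m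

    ∞⇒hasRoot : ∀ i s → evalForest U₂ (indicator i) s ≡ ∞ → HasRoot i s
    ∞⇒hasRoot i (node b u ∷ s) e with i Fin.≟ to b
    ... | yes p = here p
    ... | no  _ = there (∞⇒hasRoot i s e)

    injective : ∀ {b c} → to b ≡ to c → b B.≈ c
    injective {b} {c} e =
      B.trans (B.sym (strictlyInverseʳ b)) (B.trans (from-cong e) (strictlyInverseʳ c))

  -- For a root label `b` of `s`, the coordinate of `b` is `∞` on `s` and hence on `t`, which forces
  -- a root of `t` with the same index, thus with a label equal to `b`.
  indicators-separate : ∀ s t →
    (∀ i → evalForest U₂ (indicator i) s ≡ evalForest U₂ (indicator i) t) → Sim B 1 s t
  indicators-separate s t e = TypesIn⇒Sim {B} 0 (go s t e) (go t s (≡.sym ∘ e))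
    where
    go : ∀ s t → (∀ i → evalForest U₂ (indicator i) s ≡ evalForest U₂ (indicator i) t) →
         TypesIn B 0 s t
    go s t e = All.tabulate λ {(b , u)} m →
      Any.map (λ b≡c → injective b≡c , tt)
        (∞⇒hasRoot (to b) t (≡.trans (≡.sym (e (to b)))
          (hasRoot⇒∞ (to b) s (Any.map (≡.cong (to ∘ proj₁)) m))))

  -- The coordinate 0 carries no information; it is there because B may be
  -- empty whereas U₂^1+ n has at least one factor.

  private
    coordinates : Fin (suc n) → Func B (vSetoid U₂)
    coordinates zero    = c₀-letters
    coordinates (suc i) = indicator i

  rootLabels : Hom (B ^Δ) (U₂^1+ proj₁ finite)
  rootLabels = extend (U₂^1+ n) (tuple n coordinates)

  rootLabels-definite : Definite 1 rootLabels
  rootLabels-definite = constantLetters⇒definite {F = U₂^1+ n} (tuple n coordinates)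
    (tuple-constantLetters n coordinates
      λ { zero _ _ _ → ≡.refl ; (suc i) → indicator-constantLetters i })

  rootLabels-separate : α∼ B 1 FactorsThrough rootLabels
  rootLabels-separate s t e =
    indicators-separate s t (evalForest-tuple n coordinates s t e ∘ suc)

-- Wreath products that separate ∼ₖ-classes

Separating : ∀ {c} → (ForestAlgebra → Set c) → Setoid 0ℓ 0ℓ → (k n : ℕ) → Set _
Separating 𝒞 A k n = Σ[ G ∈ ForestAlgebra ] Σ[ γ ∈ Hom (A ^Δ) G ]
  IteratedWreath 𝒞 n γ × Finite (hSetoid G) × (α∼ A k FactorsThrough γ)

-- Induction on the level with one power of `U₂` per level. Finiteness of the algebra built so far
-- is carried along because it makes the next alphabet finite.
separatingPower : Finite A → ∀ k → Separating IsPowerOfU₂ A (suc k) (suc k)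
separatingPower {A} fin@(n , _) zero =
  _ , rootLabels fin , first (n , ≡.refl) (rootLabels fin) (rootLabels-definite fin)
    , IsFiniteForestAlgebra.H-finite (U₂^-isFinite n) , rootLabels-separate fin
separatingPower {A} fin (suc k) = wreathe (separatingPower fin k)
  where
  wreathe : Separating IsPowerOfU₂ A (suc k) (suc k) →
            Separating IsPowerOfU₂ A (suc (suc k)) (suc (suc k))
  wreathe (F , γ , wreath , F-finite , separates) = recordLetters (Finite-× fin F-finite)
    where
    recordLetters : Finite (A ×ₛ hSetoid F) →
                    Separating IsPowerOfU₂ A (suc (suc k)) (suc (suc k))
    recordLetters letters@(n , _) =
        F ≀ U , δ , wreath′ , finite , separates′
      where
      U = U₂^1+ n
      β : Hom ((A ×ₛ hSetoid F) ^Δ) U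
      β = rootLabels letters
      δ : Hom (A ^Δ) (F ≀ U)
      δ = _⊗_ {A} {F} {U} γ β
      wreath′ : IteratedWreath IsPowerOfU₂ (suc (suc k)) δ
      wreath′ = next {A = A} {F = F} {U} {γ} wreath (n , ≡.refl) β (rootLabels-definite letters)
      finite : Finite (hSetoid (F ≀ U))
      finite = ≀-finite {F} {U} F-finite (IsFiniteForestAlgebra.H-finite (U₂^-isFinite n))
      separates′ : α∼ A (suc (suc k)) FactorsThrough δ
      separates′ s t e = relabel-Sim⁻ {A} {F} γ (suc k) separates s t
          -- The second coordinate decides: the root labels of the relabelled forests contain the
          -- values of `γ` below the roots.
          (rootLabels-separate letters (relabel γ s) (relabel γ t) (proj₂ (⊗-≈⁻ {A} {F} γ {U} β s t e)))

-- Adjoining single copies of `U₂`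

module _ {A : Setoid 0ℓ 0ℓ} where

  reindex : {P Q R : Setoid 0ℓ 0ℓ} → Func (A ×ₛ P) R → Func Q P → Func (A ×ₛ Q) R
  reindex f π = record
    { to   = λ (a , q) → f ⟨$⟩ (a , π ⟨$⟩ q)
    ; cong = λ (e , e′) → Func.cong f (e , Func.cong π e′)
    }

  -- The projection `π` turns the label `(a , δ s)` back into `(a , γ s)`, so a test keeps its
  -- values when read over a larger algebra.
  evalForest-reindex : (γ : Hom (A ^Δ) F) (δ : Hom (A ^Δ) G)
    (f : Func (A ×ₛ hSetoid F) (vSetoid U₂)) (π : Func (hSetoid G) (hSetoid F)) →
    (∀ s → ForestAlgebra.H._≈_ F (π ⟨$⟩ Hom.onH δ s) (Hom.onH γ s)) → ∀ s →
    evalForest U₂ (reindex f π) (relabel δ s) ≡ evalForest U₂ f (relabel γ s)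
  evalForest-reindex γ δ f π e [] = ≡.refl
  evalForest-reindex {F} {G} γ δ f π e (node a s ∷ t) = H.∙-cong
    (·-cong (Func.cong f (Setoid.refl A , e s)) (evalForest-reindex {F} {G} γ δ f π e s))
    (evalForest-reindex {F} {G} γ δ f π e t)
    where open ForestAlgebra U₂

  private
    Tests : ForestAlgebra → ℕ → Set
    Tests F m = Fin m → Func (A ×ₛ hSetoid F) (vSetoid U₂)

    Adjoined : (γ : Hom (A ^Δ) F) → ∀ {m} → Tests F m → Set _
    Adjoined {F} γ f = ∃[ r ] Σ[ G ∈ ForestAlgebra ] Σ[ δ ∈ Hom (A ^Δ) G ]
      IteratedWreath IsU₂ r δ × Finite (hSetoid G) ×
      (∀ s t → ForestAlgebra.H._≈_ G (Hom.onH δ s) (Hom.onH δ t) →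
        ForestAlgebra.H._≈_ F (Hom.onH γ s) (Hom.onH γ t) ×
        (∀ i → evalForest U₂ (f i) (relabel γ s) ≡ evalForest U₂ (f i) (relabel γ t)))

  -- One factor `U₂` per test. The remaining tests are pulled back along `π` to read only the
  -- original algebra, so their number stays fixed while the wreath product grows.
  adjoin : ∀ {n} {γ : Hom (A ^Δ) F} → IteratedWreath IsU₂ n γ → Finite (hSetoid F) →
    ∀ m (f : Tests F m) → (∀ i → ConstantLetters U₂ (f i)) → Adjoined γ f
  adjoin {F} {n} {γ} wreath fin zero f const = n , F , γ , wreath , fin , λ s t e → e , λ ()
  adjoin {F} {n} {γ} wreath fin (suc m) f const =
    combine (adjoin {F ≀ U₂} {suc n} {γ′} wreath′ (≀-finite {F} {U₂} fin U₂H-finite) m f′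
               (λ i (a , h , _) → const (suc i) (a , h)))
    where
    β : Hom ((A ×ₛ hSetoid F) ^Δ) U₂
    β = extend U₂ (f zero)
    γ′ : Hom (A ^Δ) (F ≀ U₂)
    γ′ = _⊗_ {A} {F} {U₂} γ β
    wreath′ : IteratedWreath IsU₂ (suc n) γ′
    wreath′ = next {A = A} {F = F} {U₂} {γ} wreath ≡.refl β
                (constantLetters⇒definite {A ×ₛ hSetoid F} {U₂} (f zero) (const zero))
    π : Func (hSetoid (F ≀ U₂)) (hSetoid F)
    π = record { to = proj₁ ; cong = proj₁ }
    f′ : Tests (F ≀ U₂) m
    f′ i = reindex (f (suc i)) π
    unindex : ∀ i s → evalForest U₂ (f′ i) (relabel γ′ s) ≡ evalForest U₂ (f (suc i)) (relabel γ s)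
    unindex i = evalForest-reindex {F} {F ≀ U₂} γ γ′ (f (suc i)) π
                  (λ u → proj₁ (onH-⊗ {A} {F} γ {U₂} β u))
    combine : Adjoined {F ≀ U₂} γ′ f′ → Adjoined {F} γ f
    combine (r , G , δ , wreath″ , fin″ , separates) = r , G , δ , wreath″ , fin″ , λ s t e →
      let e′ , same = separates s t e
          γ≈ , β≈ = ⊗-≈⁻ {A} {F} γ {U₂} β s t e′
      in γ≈ , λ { zero    → β≈
                ; (suc i) → ≡.trans (≡.sym (unindex i s)) (≡.trans (same i) (unindex i t)) }

-- Each level takes one factor per letter of `A × H`, so the number of factors depends on the sizes
-- and is left existential.
separatingU₂ : Finite A → ∀ k → ∃[ r ] Separating IsU₂ A k r
separatingU₂ {A} fin zero =
  -- An iterated wreath product has at least one factor, so level 0 is served by an uninformative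
  -- one.
  1 , U₂ , β , first ≡.refl β (constantLetters⇒definite {A} {U₂} c₀-letters λ _ _ _ → ≡.refl)
    , U₂H-finite , λ _ _ _ → tt
  where
  β : Hom (A ^Δ) U₂
  β = extend U₂ c₀-letters
separatingU₂ {A} fin (suc k) = wreathe (separatingU₂ fin k)
  where
  wreathe : ∃[ r ] Separating IsU₂ A k r → ∃[ r ] Separating IsU₂ A (suc k) r
  wreathe (q , F , γ , wreath , F-finite , separates) = recordLetters (Finite-× fin F-finite)
    where
    recordLetters : Finite (A ×ₛ hSetoid F) → ∃[ r ] Separating IsU₂ A (suc k) r
    recordLetters letters@(n , _) =
      let r , G , δ , wreath′ , G-finite , same =
            adjoin {A} {F} {q} {γ} wreath F-finite n (indicator letters)
              (indicator-constantLetters letters)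
      in r , G , δ , wreath′ , G-finite , λ s t e →
           relabel-Sim⁻ {A} {F} γ k separates s t
             (indicators-separate letters (relabel γ s) (relabel γ t) (proj₂ (same s t e)))

-- Assembling the equivalences

separating⇒factors : ∀ {c} {𝒞 : ForestAlgebra → Set c} {k n} (α : Hom (A ^Δ) F) →
  Separating 𝒞 A k n → α FactorsThrough α∼ A k → FactorsThroughIteratedWreath 𝒞 n α
separating⇒factors α (G , γ , wreath , _ , separates) factors =
  G , γ , wreath , λ s t e → factors s t (separates s t e)

factors⇒factorsThrough∼ : ∀ {k} (α : Hom (A ^Δ) F) →
  FactorsThroughIteratedWreath IsFiniteForestAlgebra k α → α FactorsThrough α∼ A k
factors⇒factorsThrough∼ α (G , γ , wreath , factors) s t s∼t =
  factors s t (wreath⇒factorsThrough∼ wreath s t s∼t)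

factors-map : ∀ {c d} {𝒞 : ForestAlgebra → Set c} {𝒟 : ForestAlgebra → Set d} →
  (∀ {G} → 𝒞 G → 𝒟 G) → ∀ {k} (α : Hom (A ^Δ) F) →
  FactorsThroughIteratedWreath 𝒞 k α → FactorsThroughIteratedWreath 𝒟 k α
factors-map f α (G , γ , wreath , factors) = G , γ , wreath-map f wreath , factors

theorem2 : (A : Setoid 0ℓ 0ℓ) → Finite A →
    (F : ForestAlgebra) → IsFiniteForestAlgebra F →
    (α : Hom (A ^Δ) F) → Onto α →
    ( (k : ℕ) → 0 < k →
    (Definite k α ⇔ α FactorsThrough α∼ A k)
    × (α FactorsThrough α∼ A k ⇔ FactorsThroughIteratedWreath IsFiniteForestAlgebra k α)
    × (FactorsThroughIteratedWreath IsFiniteForestAlgebra k α ⇔ FactorsThroughIteratedWreath IsPowerOfU₂ k α) )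
    × ( (∃[ k ] (0 < k × Definite k α)) ⇔ (∃[ r ] FactorsThroughIteratedWreath IsU₂ r α) )
theorem2 A A-finite F F-finite α _ =
    (λ { (suc k) _ →
         mk⇔ (a⇒b (suc k)) (factorsThrough∼⇒definite (suc k) α)
       -- Powers of `U₂` are finite forest algebras, so the wreath product built for (d) also
       -- witnesses (c).
       , mk⇔ (factors-map isPowerOfU₂⇒isFinite α ∘ b⇒d k) (factors⇒factorsThrough∼ α)
       , mk⇔ (b⇒d k ∘ factors⇒factorsThrough∼ α) (factors-map isPowerOfU₂⇒isFinite α) })
  , mk⇔
      (λ (k , _ , definite) →
        let r , separating = separatingU₂ A-finite k
        in r , separating⇒factors α separating (a⇒b k definite))
      -- The number of factors bounds the degree of definiteness, so `r` itself serves as the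
      -- degree.
      (λ (r , G , γ , wreath , factors) → r , wreath-positive wreath ,
        factorsThrough∼⇒definite r α
          (factors⇒factorsThrough∼ α (G , γ , wreath-map isU₂⇒isFinite wreath , factors)))
  where
  a⇒b : ∀ k → Definite k α → α FactorsThrough α∼ A k
  a⇒b = definite⇒factorsThrough∼ α (IsFiniteForestAlgebra.+-comm F-finite)
          (IsFiniteForestAlgebra.+-idempotent F-finite)
  b⇒d : ∀ k → α FactorsThrough α∼ A (suc k) → FactorsThroughIteratedWreath IsPowerOfU₂ (suc k) α
  b⇒d k = separating⇒factors α (separatingPower A-finite k)
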